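{- Let $n \geq 1$ be a natural number; in the case $n > 1$ assume the axiom of $\boldsymbol{\Sigma}^1_n$-determinacy. Then for every Polish space $\mathcal{X}$ there exists a continuous function $u^{\mathcal{X}}_n : \mathcal{N} \to \mathcal{N}$ such that for almost all $\alpha \in \mathcal{N}$ (i.e., for all $\alpha$ in a comeager subset of $\mathcal{N}$) the set \[ \mathrm{G}^{\mathcal{X}}_{n}(\alpha) \,\triangle\, \mathrm{U}^{\mathcal{X}}(u^{\mathcal{X}}_n(\alpha)) \] is a meager subset of $\mathcal{X}$.
   Context: Notation. $\omega = \{0,1,2,\dots\}$; $\mathcal{N} = \omega^\omega$ is the Baire space with the product topology. $\triangle$ denotes symmetric difference. For $P \subseteq X \times Y$ and $x \in X$, the section $\{y \in Y : (x,y)\in P\}$ is denoted $P_x$ or $P(x)$; we write $P(x,y)$ for $(x,y) \in P$. A Polish space is a (nonempty) separable completely metrizable topological space. Coding of finite sequences. For $n\ge 1$, $\langle u_0,\dots,u_{n-1}\rangle = p_0^{u_0+1}\cdots p_{n-1}^{u_{n-1}+1}$, where $p_0<p_1<\dots$ are the primes; $\langle \emptyset\rangle = 1$. If $s=\langle u_0,\dots,u_{n-1}\rangle$ and $i<n$, then $(s)_i := u_i$; if $i \ge n$ or $s$ is not in the image of $\langle\cdot\rangle$, then $(s)_i := 0$. Put $q_k = (k)_0/((k)_1+1)$, an enumeration of the non-negative rationals. Basic open sets. For every Polish space $\mathcal{X}$ (including products) a compatible metric $d_{\mathcal{X}}$ and a dense sequence $(r^{\mathcal{X}}_i)_{i\in\omega}$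 are fixed, and $N(\mathcal{X},s)$ is the open $d_{\mathcal{X}}$-ball with center $r^{\mathcal{X}}_{(s)_0}$ and radius $q_{(s)_1}$ (the empty set if the radius is $0$). For $\mathcal{N}$ the choice is: $d_{\mathcal{N}}(\alpha,\beta) = (n+1)^{ -1}$ with $n$ least such that $\alpha(n)\neq\beta(n)$ if $\alpha \ne \beta$, $d_{\mathcal N}(\alpha,\alpha)=0$, and $r^{\mathcal{N}}_s(i) = (s)_i$. Universal sets. For every Polish space $\mathcal{X}$ define $\mathrm{U}^{\mathcal{X}}, \mathrm{F}^{\mathcal{X}}, \mathrm{G}^{\mathcal{X}}_n \subseteq \mathcal{N}\times\mathcal{X}$ ($n\ge 1$) by $\mathrm{U}^{\mathcal{X}}(\alpha,x) \iff (\exists n\in\omega)[x\in N(\mathcal{X},\alpha(n))]$; $\mathrm{F}^{\mathcal{X}}(\alpha,x)\iff \neg\,\mathrm{U}^{\mathcal{X}}(\alpha,x)$; $\mathrm{G}^{\mathcal{X}}_1(\alpha,x)\iff(\exists\gamma\in\mathcal{N})\,\mathrm{F}^{\mathcal{X}\times\mathcal{N}}(\alpha,x,\gamma)$; $\mathrm{G}^{\mathcal{X}}_{n+1}(\alpha,x)\iff(\exists\gamma\in\mathcal{N})\,\neg\,\mathrm{G}^{\mathcal{X}\times\mathcal{N}}_n(\alpha,x,\gamma)$. Thus $\mathrm{U}^{\mathcal{X}}$ is universal for the open subsets of $\mathcal{X}$ and $\mathrm{G}^{\mathcal{X}}_n$ is universal for the $\boldsymbol{\Sigma}^1_n$ subsets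 of $\mathcal{X}$. $\boldsymbol{\Sigma}^1_n$-determinacy is the statement that every two-player infinite game of perfect information on $\omega$ whose payoff set is a $\boldsymbol{\Sigma}^1_n$ subset of $\mathcal{N}$ is determined. -}

module Defs where

open import Algebra.Properties.CommutativeSemigroup using (interchange)
open import Algebra.Bundles using (CommutativeMonoid)
open import Data.Integer as ℤ using (+_; +≤+)
open import Data.List.Base using (List; []; _∷_; length; upTo; applyUpTo; cartesianProductWith)
open import Data.List.Membership.Propositional using (_∈_; find)
open import Data.List.Membership.Propositional.Properties using (∈-cartesianProductWith⁺; ∈-upTo⁺)
open import Data.List.Relation.Unary.All as All using (All; []; _∷_)
open import Data.List.Relation.Unary.Any as Any using (Any; here; there; any?)
open import Data.Nat.Base as ℕ using (ℕ; zero; suc; s≤s; z≤n; s<s; z<s; NonZero; _!; _^_)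
open import Data.Nat.Divisibility using (_∣_; ∣-trans; ∣m+n∣m⇒∣n; ∣1⇒≡1; m∣m*n; m≤n⇒m!∣n!)
open import Data.Nat.Induction using (<-rec)
open import Data.Nat.ListAction using (product)
open import Data.Nat.Primality using (Prime; prime?; prime⇒nonZero; prime⇒nonTrivial; ¬prime[1])
open import Data.Nat.Primality.Factorisation using (PrimeFactorisation; factorise)
import Data.Nat.Properties as ℕₚ
open import Data.Product using (Σ; ∃; _×_; _,_; proj₁; proj₂; map₂)
open import Data.Product.Relation.Binary.Pointwise.NonDependent using (×-setoid)
open import Data.Rational as ℚ using (ℚ; 0ℚ; ½; _/_)
import Data.Rational.Properties as ℚₚ
import Data.Rational.Unnormalised as ℚᵘ
import Data.Rational.Unnormalised.Properties as ℚᵘₚ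
open import Data.Sum using (_⊎_; inj₁; inj₂)
open import Data.Unit using (⊤; tt)
open import Function using (_⇔_; mk⇔; Equivalence; _∘_)
open import Function.Metric.Structures using (IsGeneralMetric)
open import Level using (0ℓ; Lift; lift; lower) renaming (suc to lsuc)
open import Relation.Binary using (Rel; Setoid; IsPartialOrder; IsEquivalence; _Respects_)
open import Relation.Binary.PropositionalEquality using (_≡_; _≢_; refl; sym; trans; cong; subst; subst₂; _→-setoid_)
open import Relation.Nullary using (¬_; Dec; yes; no; contradiction)
open import Relation.Nullary.Decidable using (_×-dec_; map′)
open import Relation.Unary using (Pred; Decidable; _∩_; _∪_; _⊆_; _≐_; ∁; ⋃; _∖_; Empty; _⊢_)

least : {P : Pred ℕ 0ℓ} → Decidable P → ∀ n → P n →
        ∃ λ m → P m × (∀ k → k ℕ.< m → ¬ P k)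
least {P} P? = <-rec _ step
  where
  step : ∀ n → (∀ {k} → k ℕ.< n → P k → ∃ λ m → P m × (∀ k → k ℕ.< m → ¬ P k)) →
         P n → ∃ λ m → P m × (∀ k → k ℕ.< m → ¬ P k)
  step n rec Pn with ℕₚ.anyUpTo? P? n
  ... | yes (k , k<n , Pk) = rec k<n Pk
  ... | no ¬∃              = n , Pn , λ k k<n Pk → ¬∃ (k , k<n , Pk)

suc∣! : ∀ {m n} → suc m ℕ.≤ n → suc m ∣ n !
suc∣! {m} m<n = ∣-trans (m∣m*n (m !)) (m≤n⇒m!∣n! m<n)

primeAbove : ∀ n → ∃ λ p → n ℕ.< p × Prime p
primeAbove n = go factors isFactorisation factorsPrime
  where
  open PrimeFactorisation (factorise (suc (n !)))

  bigger : ∀ p → Prime p → p ∣ suc (n !) → n ℕ.< p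
  bigger p pr p∣ with n ℕₚ.<? p
  ... | yes n<p = n<p
  bigger zero    pr p∣ | no n≮p = contradiction (prime⇒nonZero pr) (λ ())
  bigger (suc m) pr p∣ | no n≮p =
    contradiction (subst Prime (∣1⇒≡1 p∣1) pr) ¬prime[1]
    where
    p∣1 : suc m ∣ 1
    p∣1 = ∣m+n∣m⇒∣n (subst (suc m ∣_) (ℕₚ.+-comm 1 (n !)) p∣) (suc∣! (ℕₚ.≮⇒≥ n≮p))

  go : ∀ ps → suc (n !) ≡ product ps → All Prime ps → ∃ λ p → n ℕ.< p × Prime p
  go [] eq _ = contradiction (ℕₚ.suc-injective eq) (ℕ.≢-nonZero⁻¹ (n !) {{n ℕₚ.!≢0}})
  go (p ∷ ps) eq (pr ∷ _) = p , bigger p pr (subst (p ∣_) (sym eq) (m∣m*n (product ps))) , pr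

nextPrime : ∀ n → ∃ λ p → (n ℕ.< p × Prime p) × (∀ k → k ℕ.< p → ¬ (n ℕ.< k × Prime k))
nextPrime n = least (λ p → (n ℕₚ.<? p) ×-dec prime? p) (proj₁ above) (proj₂ above)
  where above = primeAbove n

nthPrime : ℕ → ℕ
nthPrime zero    = 2
nthPrime (suc i) = proj₁ (nextPrime (nthPrime i))

-- codeFrom k (u₀ ∷ … ∷ uₙ₋₁ ∷ []) = p_k ^ (u₀ + 1) * … * p_{k+n-1} ^ (uₙ₋₁ + 1)
codeFrom : ℕ → List ℕ → ℕ
codeFrom k []       = 1
codeFrom k (u ∷ us) = nthPrime k ^ suc u ℕ.* codeFrom (suc k) us

⟪_⟫ : List ℕ → ℕ
⟪ us ⟫ = codeFrom 0 us

nthPrime≥2 : ∀ k → 2 ℕ.≤ nthPrime k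
nthPrime≥2 zero    = ℕₚ.≤-refl
nthPrime≥2 (suc k) = ℕₚ.≤-trans (nthPrime≥2 k)
  (ℕₚ.<⇒≤ (proj₁ (proj₁ (proj₂ (nextPrime (nthPrime k))))))

n<2^n : ∀ n → n ℕ.< 2 ^ n
n<2^n zero    = z<s
n<2^n (suc n) = ℕₚ.+-mono-≤ (ℕₚ.m^n>0 2 n) (subst (n ℕ.<_) (sym (ℕₚ.+-identityʳ (2 ^ n))) (n<2^n n))

suc<^ : ∀ k u → suc u ℕ.< nthPrime k ^ suc u
suc<^ k u = ℕₚ.<-≤-trans (n<2^n (suc u)) (ℕₚ.^-monoˡ-≤ (suc u) (nthPrime≥2 k))

length<code : ∀ k us → length us ℕ.< codeFrom k us
length<code k []       = z<s
length<code k (u ∷ us) = begin-strict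
  suc (length us)              ≤⟨ length<code (suc k) us ⟩
  codeFrom (suc k) us          <⟨ ℕₚ.m<m*n (codeFrom (suc k) us) (nthPrime k ^ suc u)
                                    {{ℕ.>-nonZero (ℕₚ.≤-<-trans z≤n (length<code (suc k) us))}}
                                    (ℕₚ.≤-<-trans (s≤s z≤n) (suc<^ k u)) ⟩
  codeFrom (suc k) us ℕ.* nthPrime k ^ suc u
                               ≡⟨ ℕₚ.*-comm (codeFrom (suc k) us) (nthPrime k ^ suc u) ⟩
  codeFrom k (u ∷ us)          ∎
  where open ℕₚ.≤-Reasoning

entries<code : ∀ k us → All (ℕ._< codeFrom k us) us
entries<code k []       = []
entries<code k (u ∷ us) =
    ℕₚ.<-≤-trans (ℕₚ.<-trans (ℕₚ.n<1+n u) (suc<^ k u)) (ℕₚ.m≤m*n _ (codeFrom (suc k) us))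
  ∷ All.map (λ v< → ℕₚ.<-≤-trans v< (ℕₚ.m≤n*m _ (nthPrime k ^ suc u))) (entries<code (suc k) us)
  where
  instance
    _ = ℕ.>-nonZero (ℕₚ.≤-<-trans z≤n (length<code (suc k) us))
    _ = ℕ.>-nonZero (ℕₚ.≤-<-trans z≤n (suc<^ k u))

listsBelow : ℕ → ℕ → List (List ℕ)
listsBelow zero    b = [] ∷ []
listsBelow (suc l) b = [] ∷ cartesianProductWith _∷_ (upTo b) (listsBelow l b)

∈-listsBelow : ∀ {l b} us → length us ℕ.≤ l → All (ℕ._< b) us → us ∈ listsBelow l b
∈-listsBelow {zero}  []       _       _         = here refl
∈-listsBelow {suc l} []       _       _         = here refl
∈-listsBelow {suc l} (u ∷ us) (s≤s p) (u< ∷ us<) =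
  there (∈-cartesianProductWith⁺ _∷_ (∈-upTo⁺ u<) (∈-listsBelow us p us<))

isCode? : ∀ s → Dec (∃ λ us → ⟪ us ⟫ ≡ s)
isCode? s = map′ (λ a → map₂ proj₂ (find a)) complete
                 (any? (λ us → ⟪ us ⟫ ℕₚ.≟ s) (listsBelow s s))
  where
  complete : (∃ λ us → ⟪ us ⟫ ≡ s) → Any (λ us → ⟪ us ⟫ ≡ s) (listsBelow s s)
  complete (us , refl) = Any.map (λ { refl → refl })
    (∈-listsBelow us (ℕₚ.<⇒≤ (length<code 0 us)) (entries<code 0 us))

nth : List ℕ → ℕ → ℕ
nth []       _       = 0
nth (u ∷ us) zero    = u
nth (u ∷ us) (suc i) = nth us i

-- entry s i is (s)ᵢ.
entry : ℕ → ℕ → ℕ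
entry s i with isCode? s
... | yes (us , _) = nth us i
... | no  _        = 0

rational : ℕ → ℚ
rational k = + entry k 0 / suc (entry k 1)

Eventually : Pred ℕ 0ℓ → Set
Eventually P = ∃ λ N → ∀ n → N ℕ.≤ n → P n

always : {P : Pred ℕ 0ℓ} → (∀ n → P n) → Eventually P
always p = 0 , λ n _ → p n

zipWithᵉ : {P Q R : Pred ℕ 0ℓ} → (∀ {n} → P n → Q n → R n) →
           Eventually P → Eventually Q → Eventually R
zipWithᵉ f (M , p) (N , q) = M ℕ.⊔ N , λ n le →
  f (p n (ℕₚ.≤-trans (ℕₚ.m≤m⊔n M N) le)) (q n (ℕₚ.≤-trans (ℕₚ.m≤n⊔m M N) le))

mapᵉ : {P Q : Pred ℕ 0ℓ} → (∀ {n} → P n → Q n) → Eventually P → Eventually Q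
mapᵉ f (N , p) = N , λ n le → f (p n le)

ℚ⁺ : Set
ℚ⁺ = ∃ λ ε → 0ℚ ℚ.< ε

-- The condition on approx is symmetric in m and n, hence bounds
-- ∣ approx m - approx n ∣.
record ℝ : Set where
  constructor mkℝ
  field
    approx : ℕ → ℚ
    cauchy : ∀ ((ε , _) : ℚ⁺) → ∃ λ N → ∀ m n → N ℕ.≤ m → N ℕ.≤ n →
             approx m ℚ.≤ approx n ℚ.+ ε

open ℝ public

infix  4 _≤ʳ_ _<ʳ_ _≃ʳ_
infixl 6 _+ʳ_

_≤ʳ_ _<ʳ_ _≃ʳ_ : Rel ℝ 0ℓ
x ≤ʳ y = ∀ ((ε , _) : ℚ⁺) → Eventually λ n → approx x n ℚ.≤ approx y n ℚ.+ ε
x <ʳ y = ∃ λ ((ε , _) : ℚ⁺) → Eventually λ n → approx x n ℚ.+ ε ℚ.≤ approx y n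
x ≃ʳ y = x ≤ʳ y × y ≤ʳ x

halve : ∀ ((ε , _) : ℚ⁺) → ∃ λ ((δ , _) : ℚ⁺) → δ ℚ.+ δ ≡ ε
halve (ε , ε>0) = (½ ℚ.* ε , ½ε>0) , eq
  where
  ½ε>0 : 0ℚ ℚ.< ½ ℚ.* ε
  ½ε>0 = subst (ℚ._< ½ ℚ.* ε) (ℚₚ.*-zeroʳ ½) (ℚₚ.*-monoʳ-<-pos ½ ε>0)
  eq : ½ ℚ.* ε ℚ.+ ½ ℚ.* ε ≡ ε
  eq = trans (sym (ℚₚ.*-distribʳ-+ ε ½ ½)) (ℚₚ.*-identityˡ ε)

interchangeℚ : ∀ a b c d → (a ℚ.+ b) ℚ.+ (c ℚ.+ d) ≡ (a ℚ.+ c) ℚ.+ (b ℚ.+ d)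
interchangeℚ = interchange (CommutativeMonoid.commutativeSemigroup ℚₚ.+-0-commutativeMonoid)

≤+ : ∀ a ((ε , _) : ℚ⁺) → a ℚ.≤ a ℚ.+ ε
≤+ a (ε , ε>0) = subst (ℚ._≤ a ℚ.+ ε) (ℚₚ.+-identityʳ a) (ℚₚ.+-monoʳ-≤ a (ℚₚ.<⇒≤ ε>0))

fromℚ : ℚ → ℝ
fromℚ q = mkℝ (λ _ → q) (λ ε → 0 , λ _ _ _ _ → ≤+ q ε)

0ʳ : ℝ
0ʳ = fromℚ 0ℚ

_+ʳ_ : ℝ → ℝ → ℝ
x +ʳ y = mkℝ (λ n → approx x n ℚ.+ approx y n) cauchy-+
  where
  cauchy-+ : ∀ ((ε , _) : ℚ⁺) → ∃ λ N → ∀ m n → N ℕ.≤ m → N ℕ.≤ n →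
             approx x m ℚ.+ approx y m ℚ.≤ (approx x n ℚ.+ approx y n) ℚ.+ ε
  cauchy-+ ε with halve ε
  ... | (δ , δ>0) , refl with cauchy x (δ , δ>0) | cauchy y (δ , δ>0)
  ... | M , p | N , q = M ℕ.⊔ N , λ m n lem len →
    subst (approx x m ℚ.+ approx y m ℚ.≤_) (interchangeℚ (approx x n) δ (approx y n) δ)
      (ℚₚ.+-mono-≤
        (p m n (ℕₚ.≤-trans (ℕₚ.m≤m⊔n M N) lem) (ℕₚ.≤-trans (ℕₚ.m≤m⊔n M N) len))
        (q m n (ℕₚ.≤-trans (ℕₚ.m≤n⊔m M N) lem) (ℕₚ.≤-trans (ℕₚ.m≤n⊔m M N) len)))

pointwise-≤ : ∀ {x y} → (∀ n → approx x n ℚ.≤ approx y n) → x ≤ʳ y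
pointwise-≤ {x} {y} p ε = always λ n → ℚₚ.≤-trans (p n) (≤+ (approx y n) ε)

pointwise-≃ : ∀ {x y} → (∀ n → approx x n ≡ approx y n) → x ≃ʳ y
pointwise-≃ {x} {y} p = pointwise-≤ {x} {y} (λ n → ℚₚ.≤-reflexive (p n)) ,
                        pointwise-≤ {y} {x} (λ n → ℚₚ.≤-reflexive (sym (p n)))

≤ʳ-refl : ∀ {x} → x ≤ʳ x
≤ʳ-refl {x} = pointwise-≤ {x} {x} (λ _ → ℚₚ.≤-refl)

≤ʳ-trans : ∀ {x y z} → x ≤ʳ y → y ≤ʳ z → x ≤ʳ z
≤ʳ-trans {x} {y} {z} p q ε with halve ε
... | (δ , δ>0) , refl = zipWithᵉ
  (λ {n} a b → ℚₚ.≤-trans a (subst (approx y n ℚ.+ δ ℚ.≤_) (ℚₚ.+-assoc (approx z n) δ δ) (ℚₚ.+-monoˡ-≤ δ b)))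
  (p (δ , δ>0)) (q (δ , δ>0))

≤ʳ-isPartialOrder : IsPartialOrder _≃ʳ_ _≤ʳ_
≤ʳ-isPartialOrder = record
  { isPreorder = record
    { isEquivalence = record
      { refl  = λ {x} → ≤ʳ-refl {x} , ≤ʳ-refl {x}
      ; sym   = λ (p , q) → q , p
      ; trans = λ {x} {y} {z} (p , p′) (q , q′) → ≤ʳ-trans {x} {y} {z} p q , ≤ʳ-trans {z} {y} {x} q′ p′
      }
    ; reflexive = proj₁
    ; trans     = λ {x} {y} {z} → ≤ʳ-trans {x} {y} {z}
    }
  ; antisym = _,_
  }

+ʳ-mono-≤ : ∀ {x x′ y y′} → x ≤ʳ x′ → y ≤ʳ y′ → x +ʳ y ≤ʳ x′ +ʳ y′
+ʳ-mono-≤ {x} {x′} {y} {y′} p q ε with halve ε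
... | (δ , δ>0) , refl = zipWithᵉ
  (λ {n} a b → subst (approx x n ℚ.+ approx y n ℚ.≤_)
                 (interchangeℚ (approx x′ n) δ (approx y′ n) δ) (ℚₚ.+-mono-≤ a b))
  (p (δ , δ>0)) (q (δ , δ>0))

x≤x+y : ∀ {x y} → 0ʳ ≤ʳ y → x ≤ʳ x +ʳ y
x≤x+y {x} {y} p ε = mapᵉ
  (λ {n} a → subst₂ ℚ._≤_ (ℚₚ.+-identityʳ (approx x n)) (sym (ℚₚ.+-assoc (approx x n) (approx y n) (proj₁ ε)))
               (ℚₚ.+-monoʳ-≤ (approx x n) a))
  (p ε)

y≤x+y : ∀ {x y} → 0ʳ ≤ʳ x → y ≤ʳ x +ʳ y
y≤x+y {x} {y} p = ≤ʳ-trans {y} {y +ʳ x} {x +ʳ y} (x≤x+y {y} {x} p)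
  (proj₁ (pointwise-≃ {y +ʳ x} {x +ʳ y} (λ n → ℚₚ.+-comm (approx y n) (approx x n))))

≤-<ʳ-trans : ∀ {x y q} → x ≤ʳ y → y <ʳ fromℚ q → x <ʳ fromℚ q
≤-<ʳ-trans {x} {y} {q} p (ε , e) with halve ε
... | (δ , δ>0) , refl = (δ , δ>0) , zipWithᵉ
  (λ {n} a b → ℚₚ.≤-trans (ℚₚ.+-monoˡ-≤ δ a)
                 (subst (ℚ._≤ q) (sym (ℚₚ.+-assoc (approx y n) δ δ)) b))
  (p (δ , δ>0)) e

<ʳ-fromℚ-mono : ∀ {x p q} → p ℚ.≤ q → x <ʳ fromℚ p → x <ʳ fromℚ q
<ʳ-fromℚ-mono p≤q (ε , e) = ε , mapᵉ (λ a → ℚₚ.≤-trans a p≤q) e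

≤0⇒<ʳ : ∀ {x} → x ≤ʳ 0ʳ → ∀ ((ε , _) : ℚ⁺) → x <ʳ fromℚ ε
≤0⇒<ʳ {x} p (ε , ε>0) = ≤-<ʳ-trans {x} {0ʳ} p
  ((ε , ε>0) , always (λ _ → ℚₚ.≤-reflexive (ℚₚ.+-identityˡ ε)))

+ʳ-mono-< : ∀ {x y p q} → x <ʳ fromℚ p → y <ʳ fromℚ q → x +ʳ y <ʳ fromℚ (p ℚ.+ q)
+ʳ-mono-< {x} {y} {p} {q} (ε , a) (δ , b) = ε , zipWithᵉ
  (λ {n} a b → ℚₚ.≤-trans
     (subst (ℚ._≤ (approx x n ℚ.+ proj₁ ε) ℚ.+ approx y n)
       (trans (ℚₚ.+-assoc (approx x n) (proj₁ ε) (approx y n))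
         (trans (cong (approx x n ℚ.+_) (ℚₚ.+-comm (proj₁ ε) (approx y n)))
                (sym (ℚₚ.+-assoc (approx x n) (approx y n) (proj₁ ε)))))
       ℚₚ.≤-refl)
     (ℚₚ.+-mono-≤ a (ℚₚ.≤-trans (≤+ (approx y n) δ) b)))
  a b

slack : ∀ {x q} → x <ʳ fromℚ q →
        ∃ λ ((δ , _) : ℚ⁺) → ∀ y → y <ʳ fromℚ δ → x +ʳ y <ʳ fromℚ q
slack {x} {q} (δ , a) = δ , λ y (ε , b) → ε , zipWithᵉ
  (λ {n} a b → ℚₚ.≤-trans
     (ℚₚ.≤-trans (ℚₚ.≤-reflexive (ℚₚ.+-assoc (approx x n) (approx y n) (proj₁ ε)))
                 (ℚₚ.+-monoʳ-≤ (approx x n) b))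
     a)
  a b

min⁺ : ((ε , _) (δ , _) : ℚ⁺) → ∃ λ ((μ , _) : ℚ⁺) → μ ℚ.≤ ε × μ ℚ.≤ δ
min⁺ (ε , ε>0) (δ , δ>0) with ℚₚ.≤-total ε δ
... | inj₁ ε≤δ = (ε , ε>0) , ℚₚ.≤-refl , ε≤δ
... | inj₂ δ≤ε = (δ , δ>0) , δ≤ε , ℚₚ.≤-refl

record TopologicalSpace : Set₂ where
  field
    setoid : Setoid 0ℓ 0ℓ

  open Setoid setoid public using (Carrier; _≈_; isEquivalence)

  field
    Open        : Pred (Pred Carrier 0ℓ) (lsuc 0ℓ)
    Open-resp-≈ : ∀ {U} → Open U → U Respects _≈_
    Open-resp-≐ : ∀ {U V} → U ≐ V → Open U → Open V
    Open-⊤      : Open (λ _ → ⊤)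
    Open-∩      : ∀ {U V} → Open U → Open V → Open (U ∩ V)
    Open-⋃      : ∀ {I : Set} (U : I → Pred Carrier 0ℓ) → (∀ i → Open (U i)) → Open (⋃ I U)

module _ (T : TopologicalSpace) where
  open TopologicalSpace T

  Closed : Pred (Pred Carrier 0ℓ) (lsuc 0ℓ)
  Closed F = Open (∁ F)

  Closure : Pred Carrier 0ℓ → Pred Carrier (lsuc 0ℓ)
  Closure A x = ∀ U → Open U → U x → ∃ λ y → U y × A y

  NowhereDense : Pred (Pred Carrier 0ℓ) (lsuc 0ℓ)
  NowhereDense A = ∀ U → Open U → U ⊆ Closure A → Empty U

  Meager : Pred (Pred Carrier 0ℓ) (lsuc 0ℓ)
  Meager A = Σ (ℕ → Pred Carrier 0ℓ) λ N → (∀ i → NowhereDense (N i)) × A ⊆ ⋃ ℕ N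

  Comeager : Pred (Pred Carrier 0ℓ) (lsuc 0ℓ)
  Comeager A = Meager (∁ A)

  DenseSequence : Pred (ℕ → Carrier) (lsuc 0ℓ)
  DenseSequence r = ∀ U → Open U → ∀ x → U x → ∃ λ i → U (r i)

  MetricOpen : (Carrier → Carrier → ℝ) → Pred (Pred Carrier 0ℓ) 0ℓ
  MetricOpen d U = ∀ x → U x → ∃ λ ((ε , _) : ℚ⁺) → ∀ y → d x y <ʳ fromℚ ε → U y

  record CompatibleMetric : Set₁ where
    field
      dist       : Carrier → Carrier → ℝ
      isMetric   : IsGeneralMetric _≈_ _≃ʳ_ _≤ʳ_ 0ʳ _+ʳ_ dist
      compatible : ∀ U → Open U ⇔ MetricOpen dist U

    open IsGeneralMetric isMetric public
      using (cong; nonNegative; ≈⇒0; 0⇒≈; triangle) renaming (sym to dist-sym)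

    CauchySequence : Pred (ℕ → Carrier) 0ℓ
    CauchySequence a = ∀ ((ε , _) : ℚ⁺) → ∃ λ N → ∀ m n → N ℕ.≤ m → N ℕ.≤ n →
                       dist (a m) (a n) <ʳ fromℚ ε

    ConvergesTo : (ℕ → Carrier) → Pred Carrier 0ℓ
    ConvergesTo a x = ∀ ((ε , _) : ℚ⁺) → Eventually λ n → dist (a n) x <ʳ fromℚ ε

    Complete : Set
    Complete = ∀ a → CauchySequence a → ∃ (ConvergesTo a)

  -- The sequence makes the space nonempty.
  record IsPolish : Set₁ where
    field
      metric   : CompatibleMetric
      complete : CompatibleMetric.Complete metric
      sequence : ℕ → Carrier
      dense    : DenseSequence sequence

Continuous : (S T : TopologicalSpace) →
             Pred (TopologicalSpace.Carrier S → TopologicalSpace.Carrier T) (lsuc 0ℓ)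
Continuous S T f = ∀ U → TopologicalSpace.Open T U → TopologicalSpace.Open S (f ⊢ U)

record PolishSpace : Set₂ where
  field
    topology : TopologicalSpace
    isPolish : IsPolish topology

  open TopologicalSpace topology public
  open IsPolish isPolish public

module _ {T : TopologicalSpace} (M : CompatibleMetric T) where
  open TopologicalSpace T
  open CompatibleMetric M

  ball : Carrier → ℚ → Pred Carrier 0ℓ
  ball x q y = dist x y <ʳ fromℚ q

  ball-open : ∀ x q → Open (ball x q)
  ball-open x q = Equivalence.from (compatible (ball x q)) λ y xy<q →
    let δ , below = slack {dist x y} xy<q in
    δ , λ z yz<δ → ≤-<ʳ-trans {dist x z} {dist x y +ʳ dist y z} (triangle x y z) (below (dist y z) yz<δ)

  centre∈ball : ∀ x ((ε , _) : ℚ⁺) → ball x ε x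
  centre∈ball x = ≤0⇒<ʳ {dist x x} (proj₁ (≈⇒0 (IsEquivalence.refl isEquivalence)))

unpair : ℕ → ℕ × ℕ
unpair zero = 0 , 0
unpair (suc k) with unpair k
... | zero  , b = suc b , 0
... | suc a , b = a , suc b

unpair-surjective : ∀ a b → ∃ λ k → unpair k ≡ (a , b)
unpair-surjective a b = onDiagonal (a ℕ.+ b) a b refl
  where
  shift : ∀ {s t} k → unpair k ≡ (suc s , t) → unpair (suc k) ≡ (s , suc t)
  shift k eq rewrite eq = refl

  turn : ∀ {t} k → unpair k ≡ (0 , t) → unpair (suc k) ≡ (suc t , 0)
  turn k eq rewrite eq = refl

  onDiagonal : ∀ n a b → a ℕ.+ b ≡ n → ∃ λ k → unpair k ≡ (a , b)
  onDiagonal n a (suc b) eq with onDiagonal n (suc a) b (trans (sym (ℕₚ.+-suc a b)) eq)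
  ... | k , e = suc k , shift k e
  onDiagonal n zero zero eq = 0 , refl
  onDiagonal (suc n) (suc a) zero eq
    with onDiagonal n 0 a (trans (sym (ℕₚ.+-identityʳ a)) (ℕₚ.suc-injective eq))
  ... | k , e = suc k , turn k e

module Product (X Y : PolishSpace) where
  module X = PolishSpace X
  module Y = PolishSpace Y
  module dX = CompatibleMetric X.metric
  module dY = CompatibleMetric Y.metric

  C : Set
  C = X.Carrier × Y.Carrier

  OpenBox : Pred C 0ℓ → Pred C (lsuc 0ℓ)
  OpenBox W (x , y) = ∃ λ U → ∃ λ V →
    X.Open U × Y.Open V × U x × V y × (∀ {a b} → U a → V b → W (a , b))

  ProductOpen : Pred (Pred C 0ℓ) (lsuc 0ℓ)
  ProductOpen W = ∀ z → W z → OpenBox W z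

  product-topology : TopologicalSpace
  product-topology = record
    { setoid      = ×-setoid X.setoid Y.setoid
    ; Open        = ProductOpen
    ; Open-resp-≈ = λ {W} oW (x≈ , y≈) w →
        let U , V , oU , oV , Ux , Vy , sub = oW _ w in
        sub (X.Open-resp-≈ oU x≈ Ux) (Y.Open-resp-≈ oV y≈ Vy)
    ; Open-resp-≐ = λ (W⊆W′ , W′⊆W) oW z w →
        let U , V , oU , oV , Ux , Vy , sub = oW z (W′⊆W w) in
        U , V , oU , oV , Ux , Vy , λ u v → W⊆W′ (sub u v)
    ; Open-⊤      = λ z _ → (λ _ → ⊤) , (λ _ → ⊤) , X.Open-⊤ , Y.Open-⊤ , tt , tt , λ _ _ → tt
    ; Open-∩      = λ oW oW′ z (w , w′) →
        let U  , V  , oU  , oV  , Ux  , Vy  , sub  = oW  z w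
            U′ , V′ , oU′ , oV′ , U′x , V′y , sub′ = oW′ z w′ in
        U ∩ U′ , V ∩ V′ , X.Open-∩ oU oU′ , Y.Open-∩ oV oV′ , (Ux , U′x) , (Vy , V′y) ,
        λ (u , u′) (v , v′) → sub u v , sub′ u′ v′
    ; Open-⋃      = λ W oW z (i , w) →
        let U , V , oU , oV , Ux , Vy , sub = oW i z w in
        U , V , oU , oV , Ux , Vy , λ u v → i , sub u v
    }

  d : C → C → ℝ
  d (x , y) (x′ , y′) = dX.dist x x′ +ʳ dY.dist y y′

  fst≤ : ∀ z z′ → dX.dist (proj₁ z) (proj₁ z′) ≤ʳ d z z′
  fst≤ (x , y) (x′ , y′) = x≤x+y {dX.dist x x′} {dY.dist y y′} dY.nonNegative

  snd≤ : ∀ z z′ → dY.dist (proj₂ z) (proj₂ z′) ≤ʳ d z z′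
  snd≤ (x , y) (x′ , y′) = y≤x+y {dX.dist x x′} {dY.dist y y′} dX.nonNegative

  +-≃ : ∀ {a a′ b b′} → a ≃ʳ a′ → b ≃ʳ b′ → a +ʳ b ≃ʳ a′ +ʳ b′
  +-≃ {a} {a′} {b} {b′} (p , p′) (q , q′) =
    +ʳ-mono-≤ {a} {a′} {b} {b′} p q , +ʳ-mono-≤ {a′} {a} {b′} {b} p′ q′

  0+0 : 0ʳ +ʳ 0ʳ ≃ʳ 0ʳ
  0+0 = pointwise-≃ {0ʳ +ʳ 0ʳ} {0ʳ} (λ _ → refl)

  d-isMetric : IsGeneralMetric (TopologicalSpace._≈_ product-topology) _≃ʳ_ _≤ʳ_ 0ʳ _+ʳ_ d
  d-isMetric = record
    { isSemiMetric = record
      { isQuasiSemiMetric = record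
        { isPreMetric = record
          { isProtoMetric = record
            { isPartialOrder  = ≤ʳ-isPartialOrder
            ; ≈-isEquivalence = TopologicalSpace.isEquivalence product-topology
            ; cong            = λ {z} {z′} {w} {w′} (p , p′) (q , q′) →
                +-≃ {dX.dist (proj₁ z) (proj₁ w)} {dX.dist (proj₁ z′) (proj₁ w′)}
                    {dY.dist (proj₂ z) (proj₂ w)} {dY.dist (proj₂ z′) (proj₂ w′)}
                    (dX.cong p q) (dY.cong p′ q′)
            ; nonNegative     = λ {z} {w} →
                ≤ʳ-trans {0ʳ} {dX.dist (proj₁ z) (proj₁ w)} {d z w} dX.nonNegative (fst≤ z w)
            }
          ; ≈⇒0 = λ {z} {w} (p , q) →
              IsEquivalence.trans ≃ʳ-equiv {d z w} {0ʳ +ʳ 0ʳ} {0ʳ}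
                (+-≃ {dX.dist (proj₁ z) (proj₁ w)} {0ʳ} {dY.dist (proj₂ z) (proj₂ w)} {0ʳ}
                  (dX.≈⇒0 p) (dY.≈⇒0 q))
                0+0
          }
        ; 0⇒≈ = λ {z} {w} (p , _) →
            dX.0⇒≈ (≤ʳ-trans {dX.dist (proj₁ z) (proj₁ w)} {d z w} {0ʳ} (fst≤ z w) p , dX.nonNegative) ,
            dY.0⇒≈ (≤ʳ-trans {dY.dist (proj₂ z) (proj₂ w)} {d z w} {0ʳ} (snd≤ z w) p , dY.nonNegative)
        }
      ; sym = λ (x , y) (x′ , y′) →
          +-≃ {dX.dist x x′} {dX.dist x′ x} {dY.dist y y′} {dY.dist y′ y}
              (dX.dist-sym x x′) (dY.dist-sym y y′)
      }
    ; triangle = λ (x , y) (x′ , y′) (x″ , y″) →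
        ≤ʳ-trans {dX.dist x x″ +ʳ dY.dist y y″}
          {(dX.dist x x′ +ʳ dX.dist x′ x″) +ʳ (dY.dist y y′ +ʳ dY.dist y′ y″)}
          {(dX.dist x x′ +ʳ dY.dist y y′) +ʳ (dX.dist x′ x″ +ʳ dY.dist y′ y″)}
          (+ʳ-mono-≤ {dX.dist x x″} {dX.dist x x′ +ʳ dX.dist x′ x″}
                     {dY.dist y y″} {dY.dist y y′ +ʳ dY.dist y′ y″}
                     (dX.triangle x x′ x″) (dY.triangle y y′ y″))
          (proj₁ (pointwise-≃
            {(dX.dist x x′ +ʳ dX.dist x′ x″) +ʳ (dY.dist y y′ +ʳ dY.dist y′ y″)}
            {(dX.dist x x′ +ʳ dY.dist y y′) +ʳ (dX.dist x′ x″ +ʳ dY.dist y′ y″)}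
            (λ n → interchangeℚ (approx (dX.dist x x′) n) (approx (dX.dist x′ x″) n)
                                (approx (dY.dist y y′) n) (approx (dY.dist y′ y″) n))))
    }
    where ≃ʳ-equiv = IsPartialOrder.isEquivalence ≤ʳ-isPartialOrder

  boxes⇒balls : ∀ W → ProductOpen W → MetricOpen product-topology d W
  boxes⇒balls W oW z@(x , y) w =
    let U , V , oU , oV , Ux , Vy , sub = oW z w
        ε , inU = Equivalence.to (dX.compatible U) oU x Ux
        δ , inV = Equivalence.to (dY.compatible V) oV y Vy
        μ , μ≤ε , μ≤δ = min⁺ ε δ
    in μ , λ z′ zz′<μ → sub
      (inU (proj₁ z′) (<ʳ-fromℚ-mono {dX.dist x (proj₁ z′)} μ≤ε
        (≤-<ʳ-trans {dX.dist x (proj₁ z′)} {d z z′} (fst≤ z z′) zz′<μ)))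
      (inV (proj₂ z′) (<ʳ-fromℚ-mono {dY.dist y (proj₂ z′)} μ≤δ
        (≤-<ʳ-trans {dY.dist y (proj₂ z′)} {d z z′} (snd≤ z z′) zz′<μ)))

  balls⇒boxes : ∀ W → MetricOpen product-topology d W → ProductOpen W
  balls⇒boxes W oW z@(x , y) w with oW z w
  ... | ε , inW with halve ε
  ... | δ , refl =
    ball X.metric x (proj₁ δ) , ball Y.metric y (proj₁ δ) ,
    ball-open X.metric x (proj₁ δ) , ball-open Y.metric y (proj₁ δ) ,
    centre∈ball X.metric x δ , centre∈ball Y.metric y δ ,
    λ {a} {b} p q → inW (a , b) (+ʳ-mono-< {dX.dist x a} {dY.dist y b} p q)

  d-metric : CompatibleMetric product-topology
  d-metric = record
    { dist       = d
    ; isMetric   = d-isMetric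
    ; compatible = λ W → mk⇔ (boxes⇒balls W) (balls⇒boxes W)
    }

  d-complete : CompatibleMetric.Complete d-metric
  d-complete a cau =
    let x , toX = X.complete (proj₁ ∘ a) λ ε → map₂ (λ c m n p q →
                    ≤-<ʳ-trans {dX.dist (proj₁ (a m)) (proj₁ (a n))} {d (a m) (a n)}
                      (fst≤ (a m) (a n)) (c m n p q)) (cau ε)
        y , toY = Y.complete (proj₂ ∘ a) λ ε → map₂ (λ c m n p q →
                    ≤-<ʳ-trans {dY.dist (proj₂ (a m)) (proj₂ (a n))} {d (a m) (a n)}
                      (snd≤ (a m) (a n)) (c m n p q)) (cau ε)
    in (x , y) , λ ε → limit x y toX toY ε (halve ε)
    where
    limit : ∀ x y → dX.ConvergesTo (proj₁ ∘ a) x → dY.ConvergesTo (proj₂ ∘ a) y →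
            ((ε , _) : ℚ⁺) → (∃ λ ((δ , _) : ℚ⁺) → δ ℚ.+ δ ≡ ε) →
            Eventually λ n → d (a n) (x , y) <ʳ fromℚ ε
    limit x y toX toY ε (δ , refl) = zipWithᵉ
      (λ {n} → +ʳ-mono-< {dX.dist (proj₁ (a n)) x} {dY.dist (proj₂ (a n)) y})
      (toX δ) (toY δ)

  grid : ℕ → C
  grid k = X.sequence (proj₁ (unpair k)) , Y.sequence (proj₂ (unpair k))

  grid-dense : DenseSequence product-topology grid
  grid-dense W oW z w with oW z w
  ... | U , V , oU , oV , Ux , Vy , sub with X.dense U oU _ Ux | Y.dense V oV _ Vy
  ... | i , Ui | j , Vj with unpair-surjective i j
  ... | k , eq = k , sub (subst (U ∘ X.sequence ∘ proj₁) (sym eq) Ui)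
                         (subst (V ∘ Y.sequence ∘ proj₂) (sym eq) Vj)

infixr 2 _⊗_

_⊗_ : PolishSpace → PolishSpace → PolishSpace
X ⊗ Y = record
  { topology = product-topology
  ; isPolish = record
    { metric   = d-metric
    ; complete = d-complete
    ; sequence = grid
    ; dense    = grid-dense
    }
  }
  where open Product X Y

Seq : Set
Seq = ℕ → ℕ

Agree : ℕ → Rel Seq 0ℓ
Agree n α β = ∀ i → i ℕ.< n → α i ≡ β i

IsBaireDistance : Pred (Seq → Seq → ℝ) 0ℓ
IsBaireDistance d =
  (∀ α β → (∀ i → α i ≡ β i) → d α β ≃ʳ 0ʳ) ×
  (∀ α β n → Agree n α β → α n ≢ β n → d α β ≃ʳ fromℚ (+ 1 / suc n))

unitFrac : ℕ → ℚ
unitFrac n = + 1 / suc n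

fromℚᵘ-mono : ∀ {p q} → p ℚᵘ.≤ q → ℚ.fromℚᵘ p ℚ.≤ ℚ.fromℚᵘ q
fromℚᵘ-mono {p} {q} p≤q = ℚₚ.toℚᵘ-cancel-≤
  (ℚᵘₚ.≤-trans (ℚᵘₚ.≤-reflexive (ℚₚ.toℚᵘ-fromℚᵘ p))
    (ℚᵘₚ.≤-trans p≤q (ℚᵘₚ.≤-reflexive (ℚᵘₚ.≃-sym (ℚₚ.toℚᵘ-fromℚᵘ q)))))

unitFrac-anti : ∀ {m n} → m ℕ.≤ n → unitFrac n ℚ.≤ unitFrac m
unitFrac-anti {m} {n} m≤n = fromℚᵘ-mono {ℚᵘ.mkℚᵘ (+ 1) n} {ℚᵘ.mkℚᵘ (+ 1) m}
  (ℚᵘ.*≤* (+≤+ (ℕₚ.+-monoˡ-≤ 0 (s≤s m≤n))))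

unitFrac-cancel : ∀ {m n} → unitFrac n ℚ.< unitFrac m → m ℕ.< n
unitFrac-cancel {m} {n} lt with m ℕₚ.<? n
... | yes m<n = m<n
... | no  m≮n = contradiction (ℚₚ.<-≤-trans lt (unitFrac-anti (ℕₚ.≮⇒≥ m≮n))) (ℚₚ.<-irrefl refl)

unitFrac>0 : ∀ n → 0ℚ ℚ.< unitFrac n
unitFrac>0 n = ℚₚ.positive⁻¹ (unitFrac n) {{ℚₚ.normalize-pos 1 (suc n)}}

archimedean : ∀ ((ε , _) : ℚ⁺) → ∃ λ n → unitFrac n ℚ.≤ ε
archimedean (ε@(ℚ.mkℚ ℤ.+[1+ k ] n _) , _) = n , subst (unitFrac n ℚ.≤_) (ℚₚ.fromℚᵘ-toℚᵘ ε)
  (fromℚᵘ-mono {ℚᵘ.mkℚᵘ (+ 1) n} {ℚ.toℚᵘ ε} (ℚᵘ.*≤* (+≤+ (ℕₚ.*-monoˡ-≤ (suc n) (s≤s {n = k} z≤n)))))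
archimedean (ℚ.mkℚ (+ 0) n _ , ℚ.*<* (ℤ.+<+ ()))
archimedean (ℚ.mkℚ ℤ.-[1+ k ] n _ , ℚ.*<* ())

-- The least i < k with α i ≢ β i, or k if there is none.
firstDiff : ℕ → Seq → Seq → ℕ
firstDiff zero    α β = 0
firstDiff (suc k) α β with α 0 ℕₚ.≟ β 0
... | yes _ = suc (firstDiff k (α ∘ suc) (β ∘ suc))
... | no  _ = 0

agree-firstDiff : ∀ k α β → Agree (firstDiff k α β) α β
agree-firstDiff (suc k) α β i i< with α 0 ℕₚ.≟ β 0
agree-firstDiff (suc k) α β zero    i<       | yes eq = eq
agree-firstDiff (suc k) α β (suc i) (s≤s i<) | yes eq = agree-firstDiff k (α ∘ suc) (β ∘ suc) i i<

differ-firstDiff : ∀ k α β → firstDiff k α β ℕ.< k → α (firstDiff k α β) ≢ β (firstDiff k α β)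
differ-firstDiff (suc k) α β lt with α 0 ℕₚ.≟ β 0
differ-firstDiff (suc k) α β (s≤s lt) | yes _  = differ-firstDiff k (α ∘ suc) (β ∘ suc) lt
differ-firstDiff (suc k) α β lt       | no neq = neq

firstDiff-≥ : ∀ {k n α β} → Agree n α β → n ℕ.≤ k → n ℕ.≤ firstDiff k α β
firstDiff-≥ {k} {zero} ag z≤n = z≤n
firstDiff-≥ {suc k} {suc n} {α} {β} ag (s≤s n≤k) with α 0 ℕₚ.≟ β 0
... | yes _  = s≤s (firstDiff-≥ (λ i i<n → ag (suc i) (s≤s i<n)) n≤k)
... | no neq = contradiction (ag 0 z<s) neq

firstDiff-≡ : ∀ {k n α β} → Agree n α β → α n ≢ β n → n ℕ.< k → firstDiff k α β ≡ n
firstDiff-≡ {k} {n} {α} {β} ag neq n<k with n ℕₚ.<? firstDiff k α β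
... | yes n<fd = contradiction (agree-firstDiff k α β n n<fd) neq
... | no  n≮fd = ℕₚ.≤-antisym (ℕₚ.≮⇒≥ n≮fd) (firstDiff-≥ ag (ℕₚ.<⇒≤ n<k))

firstDiff-sym : ∀ k α β → firstDiff k α β ≡ firstDiff k β α
firstDiff-sym zero    α β = refl
firstDiff-sym (suc k) α β with α 0 ℕₚ.≟ β 0 | β 0 ℕₚ.≟ α 0
... | yes _ | yes _ = cong suc (firstDiff-sym k (α ∘ suc) (β ∘ suc))
... | no _  | no _  = refl
... | yes p | no q  = contradiction (sym p) q
... | no p  | yes q = contradiction (sym q) p

firstDiff-cong : ∀ k {α α′ β β′} → (∀ i → α i ≡ α′ i) → (∀ i → β i ≡ β′ i) →
                 firstDiff k α β ≡ firstDiff k α′ β′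
firstDiff-cong zero    p q = refl
firstDiff-cong (suc k) {α} {α′} {β} {β′} p q with α 0 ℕₚ.≟ β 0 | α′ 0 ℕₚ.≟ β′ 0
... | yes _ | yes _ = cong suc (firstDiff-cong k (p ∘ suc) (q ∘ suc))
... | no _  | no _  = refl
... | yes e | no n  = contradiction (trans (sym (p 0)) (trans e (q 0))) n
... | no n  | yes e = contradiction (trans (p 0) (trans e (sym (q 0)))) n

firstDiff≤ : ∀ k α β → firstDiff k α β ℕ.≤ k
firstDiff≤ zero    α β = z≤n
firstDiff≤ (suc k) α β with α 0 ℕₚ.≟ β 0
... | yes _ = s≤s (firstDiff≤ k (α ∘ suc) (β ∘ suc))
... | no  _ = z≤n

unitFrac≤+ˡ : ∀ a b → unitFrac a ℚ.≤ unitFrac a ℚ.+ unitFrac b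
unitFrac≤+ˡ a b = ≤+ (unitFrac a) (unitFrac b , unitFrac>0 b)

unitFrac≤+ʳ : ∀ a b → unitFrac b ℚ.≤ unitFrac a ℚ.+ unitFrac b
unitFrac≤+ʳ a b = subst (unitFrac b ℚ.≤_) (ℚₚ.+-comm (unitFrac b) (unitFrac a)) (unitFrac≤+ˡ b a)

baireDist : Seq → Seq → ℝ
baireDist α β = mkℝ (λ k → unitFrac (firstDiff k α β)) cauchy-dist
  where
  cauchy-dist : ∀ ((ε , _) : ℚ⁺) → ∃ λ N → ∀ m n → N ℕ.≤ m → N ℕ.≤ n →
                unitFrac (firstDiff m α β) ℚ.≤ unitFrac (firstDiff n α β) ℚ.+ ε
  cauchy-dist (ε , ε>0) with archimedean (ε , ε>0)
  ... | N , uN≤ε = N , bound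
    where
    bound : ∀ m n → N ℕ.≤ m → N ℕ.≤ n →
            unitFrac (firstDiff m α β) ℚ.≤ unitFrac (firstDiff n α β) ℚ.+ ε
    bound m n N≤m N≤n with firstDiff m α β ℕₚ.<? N
    ... | no  fd≮N = ℚₚ.≤-trans (unitFrac-anti (ℕₚ.≮⇒≥ fd≮N)) (ℚₚ.≤-trans uN≤ε
      (subst (ℚ._≤ unitFrac (firstDiff n α β) ℚ.+ ε) (ℚₚ.+-identityˡ ε)
        (ℚₚ.+-monoˡ-≤ ε (ℚₚ.<⇒≤ (unitFrac>0 (firstDiff n α β))))))
    ... | yes fd<N = subst (λ j → unitFrac (firstDiff m α β) ℚ.≤ unitFrac j ℚ.+ ε)
      (sym (firstDiff-≡ (agree-firstDiff m α β)
        (differ-firstDiff m α β (ℕₚ.<-≤-trans fd<N N≤m)) (ℕₚ.<-≤-trans fd<N N≤n)))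
      (≤+ (unitFrac (firstDiff m α β)) (ε , ε>0))

dist-near : ∀ ((ε , _) : ℚ⁺) → ∃ λ n → ∀ α β → Agree n α β → baireDist α β <ʳ fromℚ ε
dist-near ε with halve ε
... | (δ , δ>0) , refl with archimedean (δ , δ>0)
... | n , un≤δ = n , λ α β ag → (δ , δ>0) , n , λ k n≤k →
  ℚₚ.+-monoˡ-≤ δ (ℚₚ.≤-trans (unitFrac-anti (firstDiff-≥ ag n≤k)) un≤δ)

dist-far : ∀ {α β} n → baireDist α β <ʳ fromℚ (unitFrac n) → Agree (suc n) α β
dist-far {α} {β} n ((ε , ε>0) , N , p) i i<sn = agree-firstDiff N α β i (ℕₚ.<-≤-trans i<sn n<fd)
  where
  n<fd : n ℕ.< firstDiff N α β
  n<fd = unitFrac-cancel (ℚₚ.<-≤-trans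
    (subst (ℚ._< unitFrac (firstDiff N α β) ℚ.+ ε) (ℚₚ.+-identityʳ _)
      (ℚₚ.+-monoʳ-< (unitFrac (firstDiff N α β)) ε>0))
    (p N ℕₚ.≤-refl))

dist-zero : ∀ {α β} → (∀ i → α i ≡ β i) → baireDist α β ≃ʳ 0ʳ
dist-zero {α} {β} eq =
  (λ ε → let n , un≤ε = archimedean ε in n , λ k n≤k →
    ℚₚ.≤-trans (unitFrac-anti (firstDiff-≥ (λ i _ → eq i) n≤k))
      (ℚₚ.≤-trans un≤ε (ℚₚ.≤-reflexive (sym (ℚₚ.+-identityˡ (proj₁ ε)))))) ,
  pointwise-≤ {0ʳ} {baireDist α β} (λ k → ℚₚ.<⇒≤ (unitFrac>0 (firstDiff k α β)))

baireDist-isBaireDistance : IsBaireDistance baireDist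
baireDist-isBaireDistance = (λ _ _ → dist-zero) , λ α β n ag neq →
  let eq : ∀ k → suc n ℕ.≤ k → firstDiff k α β ≡ n
      eq k n<k = firstDiff-≡ ag neq n<k
  in (λ ε → suc n , λ k n<k → ℚₚ.≤-trans (ℚₚ.≤-reflexive (cong unitFrac (eq k n<k))) (≤+ (unitFrac n) ε)) ,
     (λ ε → suc n , λ k n<k → subst (λ j → unitFrac n ℚ.≤ unitFrac j ℚ.+ proj₁ ε)
                                (sym (eq k n<k)) (≤+ (unitFrac n) ε))

BaireOpen : Pred (Pred Seq 0ℓ) 0ℓ
BaireOpen U = ∀ α → U α → ∃ λ n → ∀ β → Agree n α β → U β

-- The product topology, with ω discrete.
baire-topology : TopologicalSpace
baire-topology = record
  { setoid      = ℕ →-setoid ℕ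
  ; Open        = λ U → Lift (lsuc 0ℓ) (BaireOpen U)
  ; Open-resp-≈ = λ oU {α} {β} α≈β Uα → proj₂ (lower oU α Uα) β (λ i _ → α≈β i)
  ; Open-resp-≐ = λ (U⊆V , V⊆U) oU → lift λ α Vα →
      map₂ (λ inU β ag → U⊆V (inU β ag)) (lower oU α (V⊆U Vα))
  ; Open-⊤      = lift λ _ _ → 0 , λ _ _ → tt
  ; Open-∩      = λ oU oV → lift λ α (Uα , Vα) →
      let m , inU = lower oU α Uα
          n , inV = lower oV α Vα
      in m ℕ.⊔ n , λ β ag →
           inU β (λ i i< → ag i (ℕₚ.<-≤-trans i< (ℕₚ.m≤m⊔n m n))) ,
           inV β (λ i i< → ag i (ℕₚ.<-≤-trans i< (ℕₚ.m≤n⊔m m n)))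
  ; Open-⋃      = λ U oU → lift λ α (i , Uα) →
      map₂ (λ inU β ag → i , inU β ag) (lower (oU i) α Uα)
  }

baire-isMetric : IsGeneralMetric (TopologicalSpace._≈_ baire-topology) _≃ʳ_ _≤ʳ_ 0ʳ _+ʳ_ baireDist
baire-isMetric = record
  { isSemiMetric = record
    { isQuasiSemiMetric = record
      { isPreMetric = record
        { isProtoMetric = record
          { isPartialOrder  = ≤ʳ-isPartialOrder
          ; ≈-isEquivalence = TopologicalSpace.isEquivalence baire-topology
          ; cong            = λ {α} {α′} {β} {β′} p q →
              pointwise-≃ {baireDist α β} {baireDist α′ β′} (λ k → cong unitFrac (firstDiff-cong k p q))
          ; nonNegative     = λ {α} {β} →
              pointwise-≤ {0ʳ} {baireDist α β} (λ k → ℚₚ.<⇒≤ (unitFrac>0 (firstDiff k α β)))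
          }
        ; ≈⇒0 = dist-zero
        }
      ; 0⇒≈ = λ {α} {β} (p , _) i → dist-far {α} {β} i
          (≤0⇒<ʳ {baireDist α β} p (unitFrac i , unitFrac>0 i)) i (ℕₚ.n<1+n i)
      }
    ; sym = λ α β → pointwise-≃ {baireDist α β} {baireDist β α} (λ k → cong unitFrac (firstDiff-sym k α β))
    }
  ; triangle = λ α β γ → pointwise-≤ {baireDist α γ} {baireDist α β +ʳ baireDist β γ} (ultra α β γ)
  }
  where
  ultra : ∀ α β γ k → unitFrac (firstDiff k α γ) ℚ.≤
                      unitFrac (firstDiff k α β) ℚ.+ unitFrac (firstDiff k β γ)
  ultra α β γ k with ℕₚ.≤-total (firstDiff k α β) (firstDiff k β γ)
  ... | inj₁ le = ℚₚ.≤-trans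
    (unitFrac-anti (firstDiff-≥ (λ i i< → trans (agree-firstDiff k α β i i<)
      (agree-firstDiff k β γ i (ℕₚ.<-≤-trans i< le))) (firstDiff≤ k α β)))
    (unitFrac≤+ˡ (firstDiff k α β) (firstDiff k β γ))
  ... | inj₂ le = ℚₚ.≤-trans
    (unitFrac-anti (firstDiff-≥ (λ i i< → trans (agree-firstDiff k α β i (ℕₚ.<-≤-trans i< le))
      (agree-firstDiff k β γ i i<)) (firstDiff≤ k β γ)))
    (unitFrac≤+ʳ (firstDiff k α β) (firstDiff k β γ))

baire-metric : CompatibleMetric baire-topology
baire-metric = record
  { dist       = baireDist
  ; isMetric   = baire-isMetric
  ; compatible = λ U → mk⇔ (toMetric U) (fromMetric U)
  }
  where
  toMetric : ∀ U → TopologicalSpace.Open baire-topology U → MetricOpen baire-topology baireDist U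
  toMetric U oU α Uα = let n , inU = lower oU α Uα in
    (unitFrac n , unitFrac>0 n) , λ β αβ<un →
      inU β (λ i i<n → dist-far {α} {β} n αβ<un i (ℕₚ.<-trans i<n (ℕₚ.n<1+n n)))

  fromMetric : ∀ U → MetricOpen baire-topology baireDist U → TopologicalSpace.Open baire-topology U
  fromMetric U oU = lift λ α Uα → let ε , inU = oU α Uα in
    let n , near = dist-near ε in n , λ β ag → inU β (near α β ag)

baire-complete : CompatibleMetric.Complete baire-metric
baire-complete a cau = limit , λ ε →
  let n = proj₁ (dist-near ε)
      N , close = modulus n
  in N , λ m N≤m → proj₂ (dist-near ε) (a m) limit λ i i<n →
       let k = m ℕ.⊔ proj₁ (modulus i) in
       trans (close m k N≤m (ℕₚ.≤-trans N≤m (ℕₚ.m≤m⊔n m (proj₁ (modulus i)))) i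
               (ℕₚ.<-trans i<n (ℕₚ.n<1+n n)))
             (proj₂ (modulus i) k (proj₁ (modulus i))
               (ℕₚ.m≤n⊔m m (proj₁ (modulus i))) ℕₚ.≤-refl i (ℕₚ.n<1+n i))
  where
  modulus : ∀ n → ∃ λ N → ∀ m k → N ℕ.≤ m → N ℕ.≤ k → Agree (suc n) (a m) (a k)
  modulus n = map₂ (λ c m k p q → dist-far {a m} {a k} n (c m k p q)) (cau (unitFrac n , unitFrac>0 n))

  limit : Seq
  limit i = a (proj₁ (modulus i)) i

unfoldSeq : ℕ → Seq
unfoldSeq k zero    = proj₁ (unpair k)
unfoldSeq k (suc i) = unfoldSeq (proj₂ (unpair k)) i

unfoldSeq-prefix : ∀ n α → ∃ λ k → Agree n α (unfoldSeq k)
unfoldSeq-prefix zero    α = 0 , λ _ ()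
unfoldSeq-prefix (suc n) α with unfoldSeq-prefix n (α ∘ suc)
... | t , ag with unpair-surjective (α 0) t
... | k , eq = k , λ where
  zero    _        → sym (cong proj₁ eq)
  (suc i) (s≤s i<) → trans (ag i i<) (cong (λ p → unfoldSeq (proj₂ p) i) (sym eq))

baire-dense : DenseSequence baire-topology unfoldSeq
baire-dense U oU α Uα with lower oU α Uα
... | n , inU with unfoldSeq-prefix n α
... | k , ag = k , inU (unfoldSeq k) ag

𝒩 : PolishSpace
𝒩 = record
  { topology = baire-topology
  ; isPolish = record
    { metric   = baire-metric
    ; complete = baire-complete
    ; sequence = unfoldSeq
    ; dense    = baire-dense
    }
  }

open PolishSpace using (Carrier; topology)

∃𝒩 : (X : PolishSpace) → Pred (Carrier (X ⊗ 𝒩)) 0ℓ → Pred (Carrier X) 0ℓ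
∃𝒩 X B x = ∃ λ (γ : Seq) → B (x , γ)

Σ¹ : (n : ℕ) .{{_ : NonZero n}} (X : PolishSpace) → Pred (Pred (Carrier X) 0ℓ) (lsuc 0ℓ)
Σ¹ (suc zero)    X A = ∃ λ F → Closed (topology (X ⊗ 𝒩)) F × A ≐ ∃𝒩 X F
Σ¹ (suc (suc n)) X A = ∃ λ B → Σ¹ (suc n) (X ⊗ 𝒩) B × A ≐ ∃𝒩 X (∁ B)

-- A strategy maps the sequence of all previous moves to the next move;
-- player I makes the even-numbered moves and wins iff the play lies in the
-- payoff set.
Strategy : Set
Strategy = List ℕ → ℕ

FollowsI FollowsII : Strategy → Pred Seq 0ℓ
FollowsI  σ α = ∀ k → α (2 ℕ.* k) ≡ σ (applyUpTo α (2 ℕ.* k))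
FollowsII τ α = ∀ k → α (suc (2 ℕ.* k)) ≡ τ (applyUpTo α (suc (2 ℕ.* k)))

Determined : Pred (Pred Seq 0ℓ) 0ℓ
Determined A = (∃ λ σ → FollowsI σ ⊆ A) ⊎ (∃ λ τ → FollowsII τ ⊆ ∁ A)

Σ¹-Determinacy : (n : ℕ) .{{_ : NonZero n}} → Set₁
Σ¹-Determinacy n = ∀ A → Σ¹ n 𝒩 A → Determined A

-- A choice, for every Polish space, of a compatible metric (not required to
-- be complete) and a dense sequence, with the prescribed values at 𝒩.
record Presentation : Set₂ where
  field
    metric       : (X : PolishSpace) → CompatibleMetric (topology X)
    centre       : (X : PolishSpace) → ℕ → Carrier X
    centre-dense : ∀ X → DenseSequence (topology X) (centre X)
    metric-𝒩     : IsBaireDistance (CompatibleMetric.dist (metric 𝒩))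
    centre-𝒩     : ∀ s i → centre 𝒩 s i ≡ entry s i

  N : (X : PolishSpace) → ℕ → Pred (Carrier X) 0ℓ
  N X s = ball (metric X) (centre X (entry s 0)) (rational (entry s 1))

  U F : (X : PolishSpace) → Seq → Pred (Carrier X) 0ℓ
  U X α x = ∃ λ n → N X (α n) x
  F X α x = ¬ U X α x

  G : (n : ℕ) .{{_ : NonZero n}} (X : PolishSpace) → Seq → Pred (Carrier X) 0ℓ
  G (suc zero)    X α x = ∃ λ γ → F (X ⊗ 𝒩) α (x , γ)
  G (suc (suc n)) X α x = ∃ λ γ → ¬ G (suc n) (X ⊗ 𝒩) α (x , γ)

infixr 6 _△_

_△_ : {A : Set} → Pred A 0ℓ → Pred A 0ℓ → Pred A 0ℓ
A △ B = (A ∖ B) ∪ (B ∖ A)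

module Submission where

-- The relation G n is itself Σ¹ n in 𝒩 ⊗ X, and it suffices that it has the Baire property:
-- if G n △ O is meager with O open, then by Kuratowski–Ulam almost all of its sections are
-- meager, and the sections of an open set have codes depending continuously on α.
--
-- The Baire property of A follows if for every ball s, either A ∩ s is meager or A is comeager
-- in a smaller ball. For projections of closed sets this is Nikodym's argument for the Souslin
-- operation. For n > 1 play the Banach–Mazur game in s, with illegal moves replaced by legal
-- ones: the outcome depends continuously on the play, so the payoff set is Σ¹ n and a winning
-- strategy exists. A point off the nowhere dense sets of points that escape every reply of the
-- strategy at some position is the outcome of a play following the strategy.

open import Axiom.ExcludedMiddle using (ExcludedMiddle)
open import Data.Bool.Base using (Bool; true; false; not; if_then_else_)
open import Data.Bool.Properties using (not-involutive)
open import Data.Integer using (+_)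
open import Data.List.Base using (List; []; _∷_; _∷ʳ_; length; foldl; applyUpTo)
open import Data.List.Properties using (applyUpTo-∷ʳ; foldl-∷ʳ; ∷-injectiveˡ; ∷-injectiveʳ; length-applyUpTo; length-++)
open import Data.Nat using (ℕ; zero; suc; NonZero; _≤_; _<_; _⊔_; _+_; _*_; _^_; _∸_; z≤n; s≤s; z<s)
open import Data.Nat.Divisibility using (_∣_; _∤_; ∣1⇒≡1; m∣m*n; ∣m⇒∣m*n)
open import Data.Nat.Primality using (Prime; prime[2]; prime⇒nonZero; prime⇒irreducible; ¬prime[1]; euclidsLemma)
import Data.Nat.Properties as ℕₚ
open import Data.Product using (∃; _×_; _,_; proj₁; proj₂; map₁; map₂)
open import Data.Rational as ℚ using (ℚ; 0ℚ)
import Data.Rational.Properties as ℚₚ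
open import Data.Sum using (_⊎_; inj₁; inj₂; [_,_]′)
open import Function using (_∘_; Equivalence)
open import Level using (Level; 0ℓ; lift; lower) renaming (suc to lsuc)
open import Relation.Binary using (IsEquivalence; _Respects_)
open import Relation.Binary.PropositionalEquality using (_≡_; refl; sym; trans; cong; cong₂; subst)
open import Relation.Nullary using (¬_; Dec; yes; no; contradiction)
open import Relation.Nullary.Decidable using (True; toWitness; fromWitness; decidable-stable)
open import Relation.Unary using (Pred; _∩_; _∪_; _⊆_; ⋃; _∖_; _⊢_)
open import Defs

private variable
  a ℓ : Level

-- Strict and non-strict order of the reals.

<ʳ⇒≤ʳ : ∀ {x y} → x <ʳ y → x ≤ʳ y
<ʳ⇒≤ʳ {x} {y} ((ε , ε>0) , lt) (δ , δ>0) = mapᵉ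
  (λ {n} le → ℚₚ.≤-trans (≤+ (approx x n) (ε , ε>0))
    (ℚₚ.≤-trans le (≤+ (approx y n) (δ , δ>0)))) lt

<+ε⇒≤ʳ : ∀ {x q} → (∀ ((ε , _) : ℚ⁺) → x <ʳ fromℚ (q ℚ.+ ε)) → x ≤ʳ fromℚ q
<+ε⇒≤ʳ {x} lt ε with lt ε
... | δ , le = mapᵉ (λ {n} → ℚₚ.≤-trans (≤+ (approx x n) δ)) le

<ʳ0⇒⊥ : ∀ {x} → 0ʳ ≤ʳ x → ¬ x <ʳ 0ʳ
<ʳ0⇒⊥ {x} 0≤x ((ε , ε>0) , lt) with halve (ε , ε>0)
... | (δ , δ>0) , refl with zipWithᵉ {R = λ n → 0ℚ ℚ.+ (δ ℚ.+ δ) ℚ.≤ 0ℚ ℚ.+ δ}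
        (λ {n} p q → ℚₚ.≤-trans (ℚₚ.+-monoˡ-≤ (δ ℚ.+ δ) p)
          (ℚₚ.≤-trans (ℚₚ.≤-reflexive (shuffle (approx x n))) (ℚₚ.+-monoˡ-≤ δ q)))
        (0≤x (δ , δ>0)) lt
  where
  shuffle : ∀ y → (y ℚ.+ δ) ℚ.+ (δ ℚ.+ δ) ≡ (y ℚ.+ (δ ℚ.+ δ)) ℚ.+ δ
  shuffle y = trans (ℚₚ.+-assoc y δ (δ ℚ.+ δ))
    (trans (cong (y ℚ.+_) (ℚₚ.+-comm δ (δ ℚ.+ δ))) (sym (ℚₚ.+-assoc y (δ ℚ.+ δ) δ)))
... | N , le = ℚₚ.<-irrefl refl (ℚₚ.<-≤-trans
  (ℚₚ.<-≤-trans (subst (ℚ._< δ ℚ.+ δ) (ℚₚ.+-identityˡ δ) (ℚₚ.+-monoˡ-< δ δ>0))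
    (ℚₚ.≤-reflexive (sym (ℚₚ.+-identityˡ (δ ℚ.+ δ)))))
  (ℚₚ.≤-trans (le N ℕₚ.≤-refl) (ℚₚ.≤-reflexive (ℚₚ.+-identityˡ δ))))

-- A copy of `P` at level 0, read off from its classical decision. Meagerness quantifies over open
-- sets and so is too large to define a `Pred` at level 0 directly.
record Small (em : ∀ {ℓ} → ExcludedMiddle ℓ) {ℓ} (P : Set ℓ) : Set where
  constructor small
  field isTrue : True (em {P = P})

module Classical (em : ∀ {ℓ} → ExcludedMiddle ℓ) where

  ⌞_⌟ : Set ℓ → Set
  ⌞ P ⌟ = Small em P

  shrink : {P : Set ℓ} → P → ⌞ P ⌟
  shrink p = small (fromWitness p)

  expand : {P : Set ℓ} → ⌞ P ⌟ → P
  expand (small p) = toWitness p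

  ¬¬-elim : {P : Set ℓ} → ¬ ¬ P → P
  ¬¬-elim = decidable-stable em

  ¬∀⇒∃¬ : {A : Set a} {P : A → Set ℓ} → ¬ (∀ x → P x) → ∃ λ x → ¬ P x
  ¬∀⇒∃¬ ¬∀ = ¬¬-elim λ ¬∃ → ¬∀ λ x → ¬¬-elim λ ¬p → ¬∃ (x , ¬p)

-- Balls and nested sequences of balls.

-- An enumeration of balls: the code t stands for the pair unpair t of the
-- index of the centre and the index of the radius.
module Balls {T : TopologicalSpace} (M : CompatibleMetric T)
             (r : ℕ → TopologicalSpace.Carrier T) (r-dense : DenseSequence T r) where
  open TopologicalSpace T using (Carrier; _≈_; Open; Open-∩)
  open CompatibleMetric M hiding (cong)

  centre : ℕ → Carrier
  centre t = r (proj₁ (unpair t))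

  size : ℕ → ℕ
  size t = proj₂ (unpair t)

  -- The bound on the second leg is not strict; allowing `η ℚ.+ η` for each leg instead of `η`
  -- leaves the margin that `<ʳ` demands.
  close-centre : ∀ {x c y q} ((η , _) : ℚ⁺) → q ℚ.≤ η → dist x c <ʳ fromℚ q → dist c y ≤ʳ fromℚ q →
                 dist x y <ʳ fromℚ ((η ℚ.+ η) ℚ.+ (η ℚ.+ η))
  close-centre {x} {c} {y} {q} (η , η>0) q≤η xc cy =
    ≤-<ʳ-trans {dist x y} {dist x c +ʳ dist c y} (triangle x c y)
      (+ʳ-mono-< {dist x c} {dist c y}
        (<ʳ-fromℚ-mono {dist x c} (ℚₚ.≤-trans q≤η (≤+ η (η , η>0))) xc)
        (≤-<ʳ-trans {dist c y} {fromℚ q} cy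
          ((η , η>0) , always (λ _ → ℚₚ.+-monoˡ-≤ η q≤η))))

  quarter : ∀ ((ε , _) : ℚ⁺) → ∃ λ ((η , _) : ℚ⁺) → (η ℚ.+ η) ℚ.+ (η ℚ.+ η) ≡ ε
  quarter ε with halve ε
  ... | δ , refl with halve δ
  ... | η , refl = η , refl

  opaque
    -- `B̄` is the closed ball: a limit of centres inherits only non-strict bounds.
    B B̄ : ℕ → Pred Carrier 0ℓ
    B  t = ball M (centre t) (unitFrac (size t))
    B̄ t y = dist (centre t) y ≤ʳ fromℚ (unitFrac (size t))

  opaque
    unfolding B

    B≡ball : ∀ t → B t ≡ ball M (centre t) (unitFrac (size t))
    B≡ball t = refl

    B⊆B̄ : ∀ t → B t ⊆ B̄ t
    B⊆B̄ t {y} = <ʳ⇒≤ʳ {dist (centre t) y} {fromℚ (unitFrac (size t))}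

    B-open : ∀ t → Open (B t)
    B-open t = ball-open M (centre t) (unitFrac (size t))

    centre∈B : ∀ t → B t (centre t)
    centre∈B t = centre∈ball M (centre t) (unitFrac (size t) , unitFrac>0 (size t))

    private
      refineTo : ∀ {U : Pred Carrier 0ℓ} {x} → ∀ k → (∃ λ ((ε , _) : ℚ⁺) → ∀ y → dist x y <ʳ fromℚ ε → U y) →
                 ∃ λ t → k < size t × B t x × B̄ t ⊆ U
      refineTo {U} {x} k (ε , inU) =
        let η , 4η≡ε = quarter ε
            m , um≤η = archimedean η
            -- Above `m`, so that the radius is at most a quarter of `ε`; above `k`, because the
            -- size has to exceed `k`.
            l = suc (m ⊔ k)
            ul≤η = ℚₚ.≤-trans (unitFrac-anti (ℕₚ.≤-trans (ℕₚ.m≤m⊔n m k) (ℕₚ.n≤1+n _))) um≤η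
            j , near = r-dense (ball M x (unitFrac l)) (ball-open M x (unitFrac l)) x
                         (centre∈ball M x (unitFrac l , unitFrac>0 l))
            t , eq = unpair-surjective j l
        in t ,
           subst (λ p → k < proj₂ p) (sym eq) (s≤s (ℕₚ.m≤n⊔m m k)) ,
           subst (λ p → ball M (r (proj₁ p)) (unitFrac (proj₂ p)) x) (sym eq)
             (≤-<ʳ-trans {dist (r j) x} {dist x (r j)} (proj₁ (dist-sym (r j) x)) near) ,
           λ {y} y∈ → inU y (subst (λ ε → dist x y <ʳ fromℚ ε) 4η≡ε
             (close-centre {x} {r j} {y} {unitFrac l} η ul≤η near
               (subst (λ p → dist (r (proj₁ p)) y ≤ʳ fromℚ (unitFrac (proj₂ p))) eq y∈)))

    refine : ∀ {U} → Open U → ∀ {x} → U x → ∀ k → ∃ λ t → k < size t × B t x × B̄ t ⊆ U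
    refine {U} oU {x} Ux k = refineTo k (Equivalence.to (compatible U) oU x Ux)

    diameter : ∀ t {x y δ} → unitFrac (size t) ℚ.≤ δ → B t x → B t y → dist x y <ʳ fromℚ (δ ℚ.+ δ)
    diameter t {x} {y} le p q = ≤-<ʳ-trans {dist x y} {dist x (centre t) +ʳ dist (centre t) y}
      (triangle x (centre t) y)
      (+ʳ-mono-< {dist x (centre t)} {dist (centre t) y}
        (<ʳ-fromℚ-mono {dist x (centre t)} le
          (≤-<ʳ-trans {dist x (centre t)} {dist (centre t) x} (proj₁ (dist-sym x (centre t))) p))
        (<ʳ-fromℚ-mono {dist (centre t) y} le q))

    ≤⇒B̄ : ∀ t {y} → dist (centre t) y ≤ʳ fromℚ (unitFrac (size t)) → B̄ t y
    ≤⇒B̄ t p = p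

    B⇒< : ∀ t {x} → B t x → dist (centre t) x <ʳ fromℚ (unitFrac (size t))
    B⇒< t p = p

  basis : ∀ {U} → Open U → ∀ {x} → U x → ∃ λ t → B t x × B t ⊆ U
  basis oU Ux = let t , _ , x∈ , sub = refine oU Ux 0 in t , x∈ , sub ∘ B⊆B̄ t

  infix 4 _⊐_
  -- Growing sizes send the radii to 0 along a chain; containment of the closed ball puts the limit
  -- into every open ball.
  _⊐_ : ℕ → ℕ → Set
  s ⊐ t = size s < size t × B̄ t ⊆ B s

  ⊐⇒⊇ : ∀ {s t} → s ⊐ t → B t ⊆ B s
  ⊐⇒⊇ {t = t} (_ , sub) y∈ = sub (B⊆B̄ t y∈)

  refine-⊐ : ∀ s {U} → Open U → ∀ {x} → U x → B s x → ∃ λ t → s ⊐ t × B t x × B t ⊆ U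
  refine-⊐ s oU Ux x∈s with refine (Open-∩ oU (B-open s)) (Ux , x∈s) (size s)
  ... | t , lt , x∈t , sub = t , (lt , proj₂ ∘ sub) , x∈t , proj₁ ∘ sub ∘ B⊆B̄ t

  module Nested (t : ℕ → ℕ) (t⊐ : ∀ n → t n ⊐ t (suc n)) where

    n≤size : ∀ n → n ≤ size (t n)
    n≤size zero    = z≤n
    n≤size (suc n) = ℕₚ.≤-<-trans (n≤size n) (proj₁ (t⊐ n))

    B-anti : ∀ {m n} → n ≤ m → B (t m) ⊆ B (t n)
    B-anti {m} {n} n≤m = subst (λ k → B (t k) ⊆ B (t n)) (ℕₚ.m∸n+n≡m n≤m) (go (m ∸ n))
      where
      go : ∀ k → B (t (k + n)) ⊆ B (t n)
      go zero    p = p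
      go (suc k) p = go k (⊐⇒⊇ (t⊐ (k + n)) p)

    centre∈ : ∀ {m n} → n ≤ m → B (t n) (centre (t m))
    centre∈ {m} n≤m = B-anti n≤m (centre∈B (t m))

    uniformly-small : ∀ ((ε , _) : ℚ⁺) → ∃ λ n → ∀ {x y} → B (t n) x → B (t n) y → dist x y <ʳ fromℚ ε
    uniformly-small ε with halve ε
    ... | δ , refl with archimedean δ
    ... | n , un≤δ = n , λ p q → diameter (t n) (ℚₚ.≤-trans (unitFrac-anti (n≤size n)) un≤δ) p q

    eventually-inside : ∀ {U} → Open U → ∀ {x} → U x → (∀ n → B (t n) x) → ∃ λ n → B (t n) ⊆ U
    eventually-inside {U} oU {x} Ux x∈ with Equivalence.to (compatible U) oU x Ux
    ... | ε , inU = map₂ (λ {n} close y∈ → inU _ (close (x∈ n) y∈)) (uniformly-small ε)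

    -- The centres form a Cauchy sequence; their limit lies in the closed ball of index `suc n`,
    -- hence in the open ball of index `n`.
    point : Complete → ∃ λ y → ∀ n → B (t n) y
    point complete = y , λ n → proj₂ (t⊐ n) (≤⇒B̄ _ (y-close (suc n)))
      where
      c : ℕ → Carrier
      c n = centre (t n)
      cauchy-c : CauchySequence c
      cauchy-c ε = map₂ (λ close m k N≤m N≤k → close (centre∈ N≤m) (centre∈ N≤k)) (uniformly-small ε)
      y = proj₁ (complete c cauchy-c)
      y-close : ∀ n → dist (c n) y ≤ʳ fromℚ (unitFrac (size (t n)))
      y-close n = <+ε⇒≤ʳ {dist (c n) y} {unitFrac (size (t n))} λ ε →
        let N , near = proj₂ (complete c cauchy-c) ε
            m = N ⊔ n
        in ≤-<ʳ-trans {dist (c n) y} {dist (c n) (c m) +ʳ dist (c m) y} (triangle (c n) (c m) y)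
             (+ʳ-mono-< {dist (c n) (c m)} {dist (c m) y}
               (B⇒< (t n) (centre∈ (ℕₚ.m≤n⊔m N n))) (near m (ℕₚ.m≤m⊔n N n)))

    unique : ∀ {x y} → (∀ n → B (t n) x) → (∀ n → B (t n) y) → x ≈ y
    unique {x} {y} p q = 0⇒≈ (<+ε⇒≤ʳ {dist x y} {0ℚ} (λ (ε , ε>0) →
      let n , close = uniformly-small (ε , ε>0)
      in subst (λ z → dist x y <ʳ fromℚ z) (sym (ℚₚ.+-identityˡ ε)) (close (p n) (q n))) , nonNegative)

-- Finite sequences and infinite plays.

applyUpTo-cong : ∀ {f g : Seq} {n} → Agree n f g → applyUpTo f n ≡ applyUpTo g n
applyUpTo-cong {n = zero}  eq = refl
applyUpTo-cong {n = suc n} eq = cong₂ _∷_ (eq 0 z<s) (applyUpTo-cong (λ i i<n → eq (suc i) (s≤s i<n)))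

applyUpTo-injective : ∀ {f g : Seq} {n} → applyUpTo f n ≡ applyUpTo g n → Agree n f g
applyUpTo-injective eq zero    (s≤s _)   = ∷-injectiveˡ eq
applyUpTo-injective eq (suc i) (s≤s i<n) = applyUpTo-injective (∷-injectiveʳ eq) i i<n

applyUpTo-nth : ∀ us → applyUpTo (nth us) (length us) ≡ us
applyUpTo-nth []       = refl
applyUpTo-nth (u ∷ us) = cong (u ∷_) (applyUpTo-nth us)

listAt : ℕ → List ℕ
listAt k = applyUpTo (unfoldSeq (proj₂ (unpair k))) (proj₁ (unpair k))

listAt-surjective : ∀ us → ∃ λ k → listAt k ≡ us
listAt-surjective us =
  let j , ag = unfoldSeq-prefix (length us) (nth us)
      k , eq = unpair-surjective (length us) j
  in k , trans (cong (λ p → applyUpTo (unfoldSeq (proj₂ p)) (proj₁ p)) eq)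
           (trans (sym (applyUpTo-cong ag)) (applyUpTo-nth us))

module Play (g : List ℕ → ℕ) where
  private
    prefix : ℕ → List ℕ
    prefix zero    = []
    prefix (suc n) = prefix n ∷ʳ g (prefix n)

  play : Seq
  play n = g (prefix n)

  play-prefix : ∀ n → applyUpTo play n ≡ prefix n
  play-prefix zero    = refl
  play-prefix (suc n) = trans (sym (applyUpTo-∷ʳ play n)) (cong (_∷ʳ play n) (play-prefix n))

  play-follows : ∀ n → play n ≡ g (applyUpTo play n)
  play-follows n = cong g (sym (play-prefix n))

-- Baire category in a Polish space.

module Category (em : ∀ {ℓ} → ExcludedMiddle ℓ) (X : PolishSpace) where
  open Classical em
  open PolishSpace X
  open Balls metric sequence dense public

  Below : ∀ {ℓ} → ℕ → Pred ℕ ℓ → Set ℓ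
  Below s P = ∃ λ t → B t ⊆ B s × P t

  nowhereDense⁺ : ∀ {A} → (∀ s → Below s (λ t → ∀ {x} → B t x → ¬ A x)) →
                  NowhereDense topology A
  nowhereDense⁺ avoid U oU U⊆cl x Ux =
    let s , _ , s⊆U      = basis oU Ux
        t , t⊆s , t∩A=∅  = avoid s
        y , y∈t , y∈A    = U⊆cl (s⊆U (t⊆s (centre∈B t))) (B t) (B-open t) (centre∈B t)
    in t∩A=∅ y∈t y∈A

  nowhereDense⁻ : ∀ {A} → NowhereDense topology A →
                  ∀ s → Below s (λ t → ∀ {x} → B t x → ¬ A x)
  nowhereDense⁻ {A} nd s = ¬¬-elim λ (none : ¬ Below s λ t → ∀ {x} → B t x → ¬ A x) →
    nd (B s) (B-open s)
      (λ x∈s U oU Ux → ¬¬-elim λ empty →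
        let t , _ , t⊆ = basis (Open-∩ oU (B-open s)) (Ux , x∈s)
        in none (t , (λ p → proj₂ (t⊆ p)) , λ y∈t y∈A → empty (_ , proj₁ (t⊆ y∈t) , y∈A)))
      (centre s) (centre∈B s)

  meager-⊆ : ∀ {A A′} → A ⊆ A′ → Meager topology A′ → Meager topology A
  meager-⊆ A⊆A′ (N , nd , A′⊆N) = N , nd , A′⊆N ∘ A⊆A′

  nowhereDense⇒meager : ∀ {A} → NowhereDense topology A → Meager topology A
  nowhereDense⇒meager {A} nd = (λ _ → A) , (λ _ → nd) , (0 ,_)

  meager-∅ : ∀ {A} → (∀ {x} → ¬ A x) → Meager topology A
  meager-∅ empty = nowhereDense⇒meager (nowhereDense⁺ λ s → s , (λ p → p) , λ _ → empty)

  meager-⋃ : ∀ {A : ℕ → Pred Carrier 0ℓ} → (∀ i → Meager topology (A i)) → Meager topology (⋃ ℕ A)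
  meager-⋃ {A} m = (λ k → proj₁ (m (proj₁ (unpair k))) (proj₂ (unpair k))) ,
                   (λ k → proj₁ (proj₂ (m (proj₁ (unpair k)))) (proj₂ (unpair k))) ,
                   covered
    where
    covered : ∀ {x} → (∃ λ i → A i x) →
              ∃ λ k → proj₁ (m (proj₁ (unpair k))) (proj₂ (unpair k)) x
    covered {x} (i , x∈A) =
      let j , x∈N = proj₂ (proj₂ (m i)) x∈A
          k , eq  = unpair-surjective i j
      in k , subst (λ p → proj₁ (m (proj₁ p)) (proj₂ p) x) (sym eq) x∈N

  meager-∪ : ∀ {A A′} → Meager topology A → Meager topology A′ → Meager topology (A ∪ A′)
  meager-∪ {A} {A′} m m′ = meager-⊆ inFamily (meager-⋃ {family} λ where
      zero    → m
      (suc _) → m′)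
    where
    family : ℕ → Pred Carrier 0ℓ
    family zero    = A
    family (suc _) = A′
    inFamily : A ∪ A′ ⊆ ⋃ ℕ family
    inFamily (inj₁ p) = 0 , p
    inFamily (inj₂ p) = 1 , p

  meager-⋃ᴸ : ∀ {A : List ℕ → Pred Carrier 0ℓ} → (∀ us → Meager topology (A us)) →
              Meager topology (⋃ (List ℕ) A)
  meager-⋃ᴸ {A} m = meager-⊆
    (λ {x} (us , p) → map₂ (λ eq → subst (λ vs → A vs x) (sym eq) p) (listAt-surjective us))
    (meager-⋃ (m ∘ listAt))

  meager-⋃-restricted : ∀ {S : Pred ℕ 0ℓ} {A : ℕ → Pred Carrier 0ℓ} →
                        (∀ {t} → S t → Meager topology (A t)) →
                        Meager topology (λ x → ∃ λ t → S t × A t x)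
  meager-⋃-restricted {S} {A} m = meager-⋃ λ t → each t em
    where
    each : ∀ t → Dec (S t) → Meager topology (λ x → S t × A t x)
    each t (yes s) = meager-⊆ proj₂ (m s)
    each t (no ¬s) = meager-∅ (¬s ∘ proj₁)

  nowhereDense-uncovered : ∀ {S : Pred ℕ 0ℓ} → (∀ s → Below s S) →
                           NowhereDense topology (λ x → ¬ ∃ λ t → S t × B t x)
  nowhereDense-uncovered below = nowhereDense⁺ λ s →
    let t , t⊆s , St = below s in t , t⊆s , λ x∈t uncovered → uncovered (t , St , x∈t)

  -- `A` is everywhere of second category in `B t`.
  NonmeagerWithin : Pred Carrier 0ℓ → Pred ℕ (lsuc 0ℓ)
  NonmeagerWithin A t = ∀ t′ → B t′ ⊆ B t → ¬ Meager topology (A ∩ B t′)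

  ¬nonmeagerWithin : ∀ {A t} → ¬ NonmeagerWithin A t →
                     Below t λ t′ → Meager topology (A ∩ B t′)
  ¬nonmeagerWithin {A} {t} ¬within =
    ¬¬-elim λ (none : ¬ Below t λ t′ → Meager topology (A ∩ B t′)) → ¬within λ t′ t′⊆t m → none (t′ , t′⊆t , m)

  -- Otherwise every ball contains one in which `A ∩ B s` is meager. Such balls are countably many
  -- and leave only a nowhere dense set uncovered, so `A ∩ B s` would be meager.
  nonmeagerWithin : ∀ {A s} → ¬ Meager topology (A ∩ B s) → Below s (NonmeagerWithin A)
  nonmeagerWithin {A} {s} nonmeager = ¬¬-elim λ (none : ¬ Below s (NonmeagerWithin A)) → nonmeager
    (meager-⊆ (λ {x} → split {x} em)
      (meager-∪ (nowhereDense⇒meager (nowhereDense-uncovered (λ u → below none u em)))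
                (meager-⋃-restricted {S} {λ t → (A ∩ B s) ∩ B t} expand)))
    where
    S : Pred ℕ 0ℓ
    S t = ⌞ Meager topology ((A ∩ B s) ∩ B t) ⌟
    below : ¬ (Below s (NonmeagerWithin A)) → ∀ u →
            Dec (∃ λ x → B u x × B s x) → Below u S
    below none u (no disjoint) = u , (λ p → p) ,
      shrink (meager-∅ λ ((_ , x∈s) , x∈u) → disjoint (_ , x∈u , x∈s))
    below none u (yes (x , x∈u , x∈s)) =
      let t , _ , t⊆ = basis (Open-∩ (B-open u) (B-open s)) (x∈u , x∈s)
          t′ , t′⊆t , m = ¬nonmeagerWithin {A} {t} λ within → none (t , (λ p → proj₂ (t⊆ p)) , within)
      in t′ , (λ p → proj₁ (t⊆ (t′⊆t p))) , shrink (meager-⊆ (λ ((p , _) , q) → p , q) m)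
    split : ∀ {x} → Dec (∃ λ t → S t × B t x) → (A ∩ B s) x →
            ((λ x → ¬ ∃ λ t → S t × B t x) ∪ (λ x → ∃ λ t → S t × ((A ∩ B s) ∩ B t) x)) x
    split (yes (t , St , x∈t)) p = inj₂ (t , St , p , x∈t)
    split (no uncovered)       p = inj₁ uncovered

  Dichotomy : Pred (Pred Carrier 0ℓ) (lsuc 0ℓ)
  Dichotomy A = ∀ s → Meager topology (A ∩ B s) ⊎ Below s λ t → Meager topology (B t ∖ A)

  BaireProperty : Pred (Pred Carrier 0ℓ) (lsuc 0ℓ)
  BaireProperty A = ∃ λ O → Open O × Meager topology (A △ O)

  -- `O` is the union of the balls in which `A` is comeager. Every ball contains one in which `A` is
  -- comeager or meager, so outside a nowhere dense set each point of `A △ O` lies in one of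
  -- countably many exceptional meager sets.
  dichotomy⇒baireProperty : ∀ {A} → Dichotomy A → BaireProperty A
  dichotomy⇒baireProperty {A} dichotomy =
    ⋃ (∃ In) (B ∘ proj₁) , Open-⋃ (B ∘ proj₁) (B-open ∘ proj₁) ,
    meager-⊆ (λ {x} → split {x} em)
      (meager-∪ (nowhereDense⇒meager (nowhereDense-uncovered {λ t → In t ⊎ Out t} below))
        (meager-∪ (meager-⋃-restricted {In} {λ t → B t ∖ A} expand)
                  (meager-⋃-restricted {Out} {λ t → A ∩ B t} expand)))
    where
    In Out : Pred ℕ 0ℓ
    In  t = ⌞ Meager topology (B t ∖ A) ⌟
    Out t = ⌞ Meager topology (A ∩ B t) ⌟
    below : ∀ s → Below s λ t → In t ⊎ Out t
    below s with dichotomy s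
    ... | inj₁ m             = s , (λ p → p) , inj₂ (shrink m)
    ... | inj₂ (t , t⊆s , m) = t , t⊆s , inj₁ (shrink m)
    split : ∀ {x} → Dec (∃ λ t → (In t ⊎ Out t) × B t x) → (A △ ⋃ (∃ In) (B ∘ proj₁)) x →
            ((λ x → ¬ ∃ λ t → (In t ⊎ Out t) × B t x) ∪
             (λ x → ∃ λ t → In t × (B t ∖ A) x) ∪ (λ x → ∃ λ t → Out t × (A ∩ B t) x)) x
    split (no uncovered) _ = inj₁ uncovered
    split (yes _) (inj₂ (((t , i) , x∈t) , x∉A)) = inj₂ (inj₁ (t , i , x∈t , x∉A))
    split (yes (t , inj₁ i , x∈t)) (inj₁ (x∈A , x∉O)) = contradiction ((t , i) , x∈t) x∉O
    split (yes (t , inj₂ o , x∈t)) (inj₁ (x∈A , x∉O)) = inj₂ (inj₂ (t , o , x∈A , x∈t))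

-- Analytic sets.

-- Nikodym's theorem for the Souslin operation, specialised to projections of closed sets.
module Analytic (em : ∀ {ℓ} → ExcludedMiddle ℓ) (X : PolishSpace)
                {F : Pred (PolishSpace.Carrier (X ⊗ 𝒩)) 0ℓ}
                (F-closed : Closed (PolishSpace.topology (X ⊗ 𝒩)) F) where
  open Classical em
  open PolishSpace X
  open Category em X

  -- The pieces of the Souslin representation: `Part []` is the whole projection, and each piece is
  -- the union of its children.
  Part : List ℕ → Pred Carrier 0ℓ
  Part us x = ∃ λ γ → applyUpTo γ (length us) ≡ us × F (x , γ)

  Part-split : ∀ us → Part us ⊆ ⋃ ℕ λ m → Part (us ∷ʳ m)
  Part-split us (γ , eq , Fxγ) = γ (length us) , γ ,
    trans (cong (applyUpTo γ) (trans (length-++ us) (ℕₚ.+-comm _ 1)))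
      (trans (sym (applyUpTo-∷ʳ γ (length us))) (cong (_∷ʳ γ (length us)) eq)) , Fxγ

  -- The points at which `Part us` is locally of second category.
  Hull : List ℕ → Pred Carrier 0ℓ
  Hull us x = ∀ t → B t x → ⌞ ¬ Meager topology (Part us ∩ B t) ⌟

  Lost : List ℕ → Pred Carrier 0ℓ
  Lost us x = Hull us x × ∀ m → ¬ Hull (us ∷ʳ m) x

  within⇒hull : ∀ {us t} → NonmeagerWithin (Part us) t → B t ⊆ Hull us
  within⇒hull within x∈t t′ x∈t′ =
    let u , _ , u⊆ = basis (Open-∩ (B-open _) (B-open t′)) (x∈t , x∈t′)
    in shrink λ m → within u (proj₁ ∘ u⊆) (meager-⊆ (λ (p , q) → p , proj₂ (u⊆ q)) m)

  -- If `Part us` is meager in `B s`, its hull misses `B s`. Otherwise one of its countably many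
  -- children is nonmeager in `B s`, and a ball below `s` lies in the hull of that child.
  Lost-nowhereDense : ∀ us → NowhereDense topology (Lost us)
  Lost-nowhereDense us = nowhereDense⁺ λ s → avoid s em
    where
    avoid : ∀ s → Dec (Meager topology (Part us ∩ B s)) →
            Below s (λ t → ∀ {x} → B t x → ¬ Lost us x)
    avoid s (yes m) = s , (λ p → p) , λ x∈s (hull , _) → expand (hull s x∈s) m
    avoid s (no nonmeager) =
      let m , nonmeager′ = ¬∀⇒∃¬ λ all → nonmeager
            (meager-⊆ (λ (p , q) → map₂ (_, q) (Part-split us p))
              (meager-⋃ {λ m → Part (us ∷ʳ m) ∩ B s} all))
          t , t⊆s , within = nonmeagerWithin nonmeager′
      in t , t⊆s , λ x∈t (_ , lost) → lost m (within⇒hull within x∈t)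

  -- As `x` is never lost, hulls containing it can be followed along a branch `play`. Were
  -- `(x , play)` outside `F`, an open box around it would miss `F`; yet the pieces along the branch
  -- are nonmeager near `x`, so `F` enters that box.
  hull⊆∃𝒩 : ∀ {x} → Hull [] x → (∀ us → ¬ Lost us x) → ∃𝒩 X F x
  hull⊆∃𝒩 {x} hull never-lost = play , ¬¬-elim outside
    where
    next : ∀ us → Dec (∃ λ m → Hull (us ∷ʳ m) x) → ℕ
    next us (yes (m , _)) = m
    next us (no _)        = 0
    next-hull : ∀ us (d : Dec (∃ λ m → Hull (us ∷ʳ m) x)) → Hull us x → Hull (us ∷ʳ next us d) x
    next-hull us (yes (_ , h)) _    = h
    next-hull us (no none)     hull = contradiction (hull , λ m h → none (m , h)) (never-lost us)

    open Play (λ us → next us em)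

    hulls : ∀ n → Hull (applyUpTo play n) x
    hulls zero    = hull
    hulls (suc n) = subst (λ us → Hull us x)
      (trans (cong (applyUpTo play n ∷ʳ_) (sym (play-follows n))) (applyUpTo-∷ʳ play n))
      (next-hull (applyUpTo play n) em (hulls n))

    outside : ¬ ¬ F (x , play)
    outside ¬Fxγ =
      let V , W , oV , oW , Vx , Wγ , sub = F-closed (x , play) ¬Fxγ
          n , inW       = lower oW play Wγ
          t , x∈t , t⊆V = basis oV Vx
      in expand (hulls n t x∈t) (meager-∅ λ ((γ , eq , Fyγ) , y∈t) →
           sub (t⊆V y∈t) (inW γ (applyUpTo-injective
             (sym (trans (cong (applyUpTo γ) (sym (length-applyUpTo play n))) eq)))) Fyγ)

  dichotomy : Dichotomy (∃𝒩 X F)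
  dichotomy s = decide em
    where
    decide : Dec (Meager topology (∃𝒩 X F ∩ B s)) →
             Meager topology (∃𝒩 X F ∩ B s) ⊎ Below s λ t → Meager topology (B t ∖ ∃𝒩 X F)
    decide (yes m) = inj₁ m
    decide (no nonmeager) =
      let t , t⊆s , within = nonmeagerWithin {Part []} {s} λ m →
            nonmeager (meager-⊆ (λ ((γ , Fxγ) , x∈s) → (γ , refl , Fxγ) , x∈s) m)
      -- `Part []` is everywhere nonmeager in `B t`, so `B t` lies in its hull, and the points of
      -- `B t` off the projection are lost somewhere.
      in inj₂ (t , t⊆s , meager-⊆
           (λ (x∈t , x∉A) → ¬∀⇒∃¬ λ never-lost → x∉A (hull⊆∃𝒩 (within⇒hull within x∈t) never-lost))
           (meager-⊆ (λ (us , ¬¬lost) → us , ¬¬-elim ¬¬lost)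
             (meager-⋃ᴸ (nowhereDense⇒meager ∘ Lost-nowhereDense))))

-- The Banach-Mazur game.

module BanachMazur (em : ∀ {ℓ} → ExcludedMiddle ℓ) (X : PolishSpace) (s : ℕ) where
  open Classical em
  open PolishSpace X
  open Category em X

  child : ∀ t → ∃ λ t′ → t ⊐ t′
  child t = let t′ , t⊐t′ , _ = refine-⊐ t (B-open t) (centre∈B t) (centre∈B t) in t′ , t⊐t′

  private
    choose : ∀ t m → Dec ⌞ t ⊐ m ⌟ → ℕ
    choose t m (yes _) = m
    choose t m (no _)  = proj₁ (child t)

    choose-⊐ : ∀ t m d → t ⊐ choose t m d
    choose-⊐ t m (yes t⊐m) = expand t⊐m
    choose-⊐ t m (no _)    = proj₂ (child t)

    choose-legal : ∀ {t m} d → t ⊐ m → choose t m d ≡ m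
    choose-legal (yes _)     t⊐m = refl
    choose-legal (no ¬t⊐m) t⊐m = contradiction (shrink t⊐m) ¬t⊐m

  opaque
    -- An illegal move m is replaced by a fixed legal one.
    next : ℕ → ℕ → ℕ
    next t m = choose t m em

    next-⊐ : ∀ t m → t ⊐ next t m
    next-⊐ t m = choose-⊐ t m em

    next-legal : ∀ {t m} → t ⊐ m → next t m ≡ m
    next-legal = choose-legal em

  at : List ℕ → ℕ
  at = foldl next s

  at-∷ʳ : ∀ p m → at (p ∷ʳ m) ≡ next (at p) m
  at-∷ʳ p m = foldl-∷ʳ next s m p

  at-⊐ : ∀ p m → at p ⊐ at (p ∷ʳ m)
  at-⊐ p m = subst (at p ⊐_) (sym (at-∷ʳ p m)) (next-⊐ (at p) m)

  stage : Seq → ℕ → ℕ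
  stage α n = at (applyUpTo α n)

  stage-⊐ : ∀ α n → stage α n ⊐ stage α (suc n)
  stage-⊐ α n = subst (λ p → stage α n ⊐ at p) (applyUpTo-∷ʳ α n) (at-⊐ (applyUpTo α n) (α n))

  module Stages (α : Seq) = Nested (stage α) (stage-⊐ α)

  outcome : Seq → Carrier
  outcome α = proj₁ (Stages.point α complete)

  outcome∈ : ∀ α n → B (stage α n) (outcome α)
  outcome∈ α = proj₂ (Stages.point α complete)

  -- Some ball of the play lies inside `U`, and it depends on finitely many moves; every play
  -- sharing these moves has its outcome in that ball.
  outcome-continuous : Continuous baire-topology topology outcome
  outcome-continuous U oU = lift λ α Uα →
    let n , sub = Stages.eventually-inside α oU Uα (outcome∈ α)
    in n , λ β α~β → sub (subst (λ p → B (at p) (outcome β)) (sym (applyUpTo-cong α~β)) (outcome∈ β n))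

  module _ (σ : Strategy) where

    round : List ℕ → ℕ → List ℕ
    round p m = (p ∷ʳ m) ∷ʳ σ (p ∷ʳ m)

    Escaping : List ℕ → Pred Carrier 0ℓ
    Escaping p x = B (at p) x × ∀ m → ¬ B (at (round p m)) x

    -- Let the opponent move to a ball inside both `B u` and the current ball. The ball after the
    -- reply of `σ` still lies in `B u`, and its points do not escape at `p`.
    Escaping-nowhereDense : ∀ p → NowhereDense topology (Escaping p)
    Escaping-nowhereDense p = nowhereDense⁺ λ u → avoid u em
      where
      avoid : ∀ u → Dec (∃ λ x → B u x × B (at p) x) → Below u λ t → ∀ {x} → B t x → ¬ Escaping p x
      avoid u (no disjoint) = u , (λ x∈u → x∈u) , λ x∈u (x∈p , _) → disjoint (_ , x∈u , x∈p)
      avoid u (yes (x , x∈u , x∈p)) =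
        let m , p⊐m , _ , m⊆u = refine-⊐ (at p) (B-open u) x∈u x∈p
            at-m = trans (at-∷ʳ p m) (next-legal p⊐m)
            inside = λ {y} (y∈ : B (at (round p m)) y) →
              subst (λ t → B t y) at-m (⊐⇒⊇ (at-⊐ (p ∷ʳ m) (σ (p ∷ʳ m))) y∈)
        in at (round p m) , (λ y∈ → m⊆u (inside y∈)) , λ y∈ (_ , escapes) → escapes m y∈

    -- At the turns not marked in ours, the opponent of σ moves so that x survives σ's reply.
    module Capture (ours : ℕ → Bool) (alternate : ∀ n → ours (suc n) ≡ not (ours n)) (x : Carrier)
                   (never-escapes : ∀ p → ¬ Escaping p x) where
      private
        move : ∀ p → Dec (∃ λ m → B (at (round p m)) x) → ℕ
        move p (yes (m , _)) = m
        move p (no _)        = 0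

        move-keeps : ∀ p d → B (at p) x → B (at (round p (move p d))) x
        move-keeps p (yes (_ , x∈)) _   = x∈
        move-keeps p (no none)      x∈p = contradiction (x∈p , λ m x∈ → none (m , x∈)) (never-escapes p)

        respond : List ℕ → ℕ
        respond p = if ours (length p) then σ p else move p em

      open Play respond public

      play-ours : ∀ n → ours n ≡ true → play n ≡ σ (applyUpTo play n)
      play-ours n eq = trans (play-follows n) (respond-ours eq (length-applyUpTo play n))
        where
        respond-ours : ∀ {p n} → ours n ≡ true → length p ≡ n → respond p ≡ σ p
        respond-ours {p} eq refl rewrite eq = refl

      private
        play-theirs : ∀ n → ours n ≡ false → play n ≡ move (applyUpTo play n) em
        play-theirs n eq = trans (play-follows n) (respond-theirs eq (length-applyUpTo play n))
          where
          respond-theirs : ∀ {p n} → ours n ≡ false → length p ≡ n → respond p ≡ move p em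
          respond-theirs {p} eq refl rewrite eq = refl

        two-moves : ∀ n → ours n ≡ false →
                    applyUpTo play (suc (suc n)) ≡ round (applyUpTo play n) (move (applyUpTo play n) em)
        two-moves n eq = trans (sym (applyUpTo-∷ʳ play (suc n)))
          (cong₂ _∷ʳ_ one-move (trans (play-ours (suc n) (trans (alternate n) (cong not eq))) (cong σ one-move)))
          where
          one-move : applyUpTo play (suc n) ≡ applyUpTo play n ∷ʳ move (applyUpTo play n) em
          one-move = trans (sym (applyUpTo-∷ʳ play n)) (cong (applyUpTo play n ∷ʳ_) (play-theirs n eq))

      step : ∀ {n} → ours n ≡ false → B (stage play n) x → B (stage play (suc (suc n))) x
      step {n} eq x∈ = subst (λ p → B (at p) x) (sym (two-moves n eq)) (move-keeps (applyUpTo play n) em x∈)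

      reach : ∀ n → ours n ≡ false → B (stage play n) x → ∀ k → ∃ λ m → k ≤ m × ours m ≡ false × B (stage play m) x
      reach n eq x∈ zero    = n , z≤n , eq , x∈
      reach n eq x∈ (suc k) =
        let m , k≤m , eq′ , x∈′ = reach n eq x∈ k
        in suc (suc m) , s≤s (ℕₚ.≤-trans k≤m (ℕₚ.n≤1+n m)) ,
           trans (alternate (suc m)) (trans (cong not (alternate m)) (trans (not-involutive _) eq′)) ,
           step eq′ x∈′

      -- `x` lies in balls arbitrarily far along the play, hence by nesting in all of them, and
      -- their radii tend to 0.
      outcome≈ : ∀ n → ours n ≡ false → B (stage play n) x → outcome play ≈ x
      outcome≈ n eq x∈ = Stages.unique play (outcome∈ play) λ k →
        let m , k≤m , _ , x∈′ = reach n eq x∈ k in Stages.B-anti play k≤m x∈′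

  even odd : ℕ → Bool
  even zero    = true
  even (suc n) = not (even n)
  odd n = not (even n)

  even-2* : ∀ k → even (2 * k) ≡ true
  even-2* zero    = refl
  even-2* (suc k) = trans (cong even (ℕₚ.*-suc 2 k)) (trans (not-involutive (even (2 * k))) (even-2* k))

  module _ {A : Pred Carrier 0ℓ} (A-resp : A Respects _≈_) where

    -- Apart from the meager set of points escaping somewhere, each point of the ball that faces the
    -- opponent's first move is the outcome of a play following the strategy. What the strategy
    -- guarantees for plays thus holds for these points.
    decided : Determined (outcome ⊢ A) → Meager topology (A ∩ B s) ⊎ Below s λ t → Meager topology (B t ∖ A)
    decided (inj₁ (σ , wins)) = inj₂ (at (σ [] ∷ []) , ⊐⇒⊇ (at-⊐ [] (σ [])) , meager-⊆
      (λ {x} (x∈t , x∉A) → ¬∀⇒∃¬ λ never-escapes →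
        let open Capture σ even (λ _ → refl) x never-escapes
        in x∉A (A-resp
             -- Player I opens with `σ []`, so the opponent's first turn is turn 1, and the point
             -- must lie in the ball reached by then.
             (outcome≈ 1 refl (subst (λ m → B (at (m ∷ [])) x) (sym (play-ours 0 refl)) x∈t))
             (wins λ k → play-ours (2 * k) (even-2* k))))
      (meager-⊆ (λ (p , ¬¬e) → p , ¬¬-elim ¬¬e) (meager-⋃ᴸ (nowhereDense⇒meager ∘ Escaping-nowhereDense σ))))
    decided (inj₂ (τ , wins)) = inj₁ (meager-⊆
      (λ {x} (x∈A , x∈s) → ¬∀⇒∃¬ λ never-escapes →
        let open Capture τ odd (λ _ → refl) x never-escapes
        in wins (λ k → play-ours (suc (2 * k)) (trans (not-involutive (even (2 * k))) (even-2* k)))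
             (A-resp (IsEquivalence.sym isEquivalence (outcome≈ 0 refl x∈s)) x∈A))
      (meager-⊆ (λ (p , ¬¬e) → p , ¬¬-elim ¬¬e) (meager-⋃ᴸ (nowhereDense⇒meager ∘ Escaping-nowhereDense τ))))

-- Prime-power codes of finite sequences.

nthPrime-prime : ∀ k → Prime (nthPrime k)
nthPrime-prime zero    = prime[2]
nthPrime-prime (suc k) = proj₂ (proj₁ (proj₂ (nextPrime (nthPrime k))))

nthPrime-mono-< : ∀ {j k} → j < k → nthPrime j < nthPrime k
nthPrime-mono-< {j} {suc k} (s≤s j≤k) with ℕₚ.m≤n⇒m<n∨m≡n j≤k
... | inj₁ j<k  = ℕₚ.<-trans (nthPrime-mono-< j<k) (proj₁ (proj₁ (proj₂ (nextPrime (nthPrime k)))))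
... | inj₂ refl = proj₁ (proj₁ (proj₂ (nextPrime (nthPrime k))))

prime∤1 : ∀ {p} → Prime p → p ∤ 1
prime∤1 pr p∣1 = ¬prime[1] (subst Prime (∣1⇒≡1 p∣1) pr)

prime∣^ : ∀ {p} → Prime p → ∀ m n → p ∣ m ^ n → p ∣ m
prime∣^ pr m zero    p∣ = contradiction p∣ (prime∤1 pr)
prime∣^ pr m (suc n) p∣ = [ (λ q → q) , prime∣^ pr m n ]′ (euclidsLemma m (m ^ n) pr p∣)

prime∣prime : ∀ {p q} → Prime p → Prime q → p ∣ q → p ≡ q
prime∣prime pp pq p∣q with prime⇒irreducible pq p∣q
... | inj₁ refl = contradiction pp ¬prime[1]
... | inj₂ p≡q  = p≡q

nthPrime∤codeFrom : ∀ {j k} → j < k → ∀ us → nthPrime j ∤ codeFrom k us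
nthPrime∤codeFrom {j} j<k []       p∣ = prime∤1 (nthPrime-prime j) p∣
nthPrime∤codeFrom {j} {k} j<k (u ∷ us) p∣
  with euclidsLemma (nthPrime k ^ suc u) (codeFrom (suc k) us) (nthPrime-prime j) p∣
... | inj₁ p∣^ = ℕₚ.<-irrefl
      (prime∣prime (nthPrime-prime j) (nthPrime-prime k) (prime∣^ (nthPrime-prime j) (nthPrime k) (suc u) p∣^))
      (nthPrime-mono-< j<k)
... | inj₂ p∣c = nthPrime∤codeFrom (ℕₚ.m<n⇒m<1+n j<k) us p∣c

^*-injective : ∀ {p} → Prime p → ∀ u v {a b} → p ∤ a → p ∤ b → p ^ u * a ≡ p ^ v * b → u ≡ v × a ≡ b
^*-injective pr zero    zero    {a} {b} p∤a p∤b eq =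
  refl , trans (sym (ℕₚ.*-identityˡ a)) (trans eq (ℕₚ.*-identityˡ b))
^*-injective {p} pr zero (suc v) {a} {b} p∤a p∤b eq = contradiction
  (subst (p ∣_) (trans (sym eq) (ℕₚ.*-identityˡ a)) (∣m⇒∣m*n b (m∣m*n (p ^ v)))) p∤a
^*-injective {p} pr (suc u) zero {a} {b} p∤a p∤b eq = contradiction
  (subst (p ∣_) (trans eq (ℕₚ.*-identityˡ b)) (∣m⇒∣m*n a (m∣m*n (p ^ u)))) p∤b
^*-injective {p} pr (suc u) (suc v) {a} {b} p∤a p∤b eq = map₁ (cong suc) (^*-injective pr u v p∤a p∤b
  (ℕₚ.*-cancelˡ-≡ _ _ p {{prime⇒nonZero pr}}
    (trans (sym (ℕₚ.*-assoc p (p ^ u) a)) (trans eq (ℕₚ.*-assoc p (p ^ v) b)))))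

-- The prime of index `k` divides no code starting at a later index, so its exponents on the two
-- sides agree and it can be peeled off.
codeFrom-injective : ∀ k us vs → codeFrom k us ≡ codeFrom k vs → us ≡ vs
codeFrom-injective k []       []       eq = refl
codeFrom-injective k []       (v ∷ vs) eq =
  contradiction (subst (nthPrime k ∣_) (sym eq) (∣m⇒∣m*n (codeFrom (suc k) vs) (m∣m*n (nthPrime k ^ v))))
    (prime∤1 (nthPrime-prime k))
codeFrom-injective k (u ∷ us) []       eq =
  contradiction (subst (nthPrime k ∣_) eq (∣m⇒∣m*n (codeFrom (suc k) us) (m∣m*n (nthPrime k ^ u))))
    (prime∤1 (nthPrime-prime k))
codeFrom-injective k (u ∷ us) (v ∷ vs) eq
  with ^*-injective (nthPrime-prime k) (suc u) (suc v)
         (nthPrime∤codeFrom (ℕₚ.n<1+n k) us) (nthPrime∤codeFrom (ℕₚ.n<1+n k) vs) eq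
... | refl , eq′ = cong (u ∷_) (codeFrom-injective (suc k) us vs eq′)

opaque
  encode : List ℕ → ℕ
  encode us = ⟪ us ⟫

  entry-encode : ∀ us i → entry (encode us) i ≡ nth us i
  entry-encode us i with isCode? ⟪ us ⟫
  ... | yes (vs , eq) = cong (λ ws → nth ws i) (codeFrom-injective 0 vs us eq)
  ... | no  none      = contradiction (us , refl) none

-- Every code exceeds the length of its sequence, so 0 is not a code and its entries take the
-- default value.
entry-0 : ∀ i → entry 0 i ≡ 0
entry-0 i with isCode? 0
... | yes (us , eq) = contradiction (subst (length us <_) eq (length<code 0 us)) λ ()
... | no  _         = refl

-- Projective classes and the universal sets.

open PolishSpace using (Carrier; topology)

onFst : ∀ {X Y : PolishSpace} → (Carrier X → Carrier Y) → Carrier (X ⊗ 𝒩) → Carrier (Y ⊗ 𝒩)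
onFst f (x , γ) = f x , γ

onFst-continuous : ∀ {X Y} {f : Carrier X → Carrier Y} → Continuous (topology X) (topology Y) f →
                   Continuous (topology (X ⊗ 𝒩)) (topology (Y ⊗ 𝒩)) (onFst {X} {Y} f)
onFst-continuous {f = f} cont W oW (x , γ) w =
  let V , V′ , oV , oV′ , Vfx , V′γ , sub = oW (f x , γ) w
  in f ⊢ V , V′ , cont V oV , oV′ , Vfx , V′γ , sub

Σ¹-preimage : ∀ n .{{_ : NonZero n}} {X Y : PolishSpace} {f : Carrier X → Carrier Y} →
              Continuous (topology X) (topology Y) f →
              ∀ {A} → Σ¹ n Y A → Σ¹ n X (f ⊢ A)
Σ¹-preimage (suc zero) {X} {Y} {f} cont (F , F-closed , A⊆ , ⊆A) =
  onFst {X} {Y} f ⊢ F , onFst-continuous {X} {Y} cont _ F-closed , A⊆ , ⊆A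
Σ¹-preimage (suc (suc n)) {X} {Y} {f} cont (B , B-Σ¹ , A⊆ , ⊆A) =
  onFst {X} {Y} f ⊢ B ,
  Σ¹-preimage (suc n) {X ⊗ 𝒩} {Y ⊗ 𝒩} (onFst-continuous {X} {Y} cont) B-Σ¹ , A⊆ , ⊆A

module _ (X Y Z : PolishSpace) where

  assocʳ : Carrier ((X ⊗ Y) ⊗ Z) → Carrier (X ⊗ (Y ⊗ Z))
  assocʳ ((x , y) , z) = x , (y , z)

  assocʳ-continuous : Continuous (topology ((X ⊗ Y) ⊗ Z)) (topology (X ⊗ (Y ⊗ Z))) assocʳ
  assocʳ-continuous W oW ((x , y) , z) w =
    let U , V , oU , oV , Ux , Vyz , sub      = oW (x , (y , z)) w
        U′ , V′ , oU′ , oV′ , U′y , V′z , sub′ = oV (y , z) Vyz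
    in (λ (a , b) → U a × U′ b) , V′ ,
       (λ (a , b) (Ua , U′b) → U , U′ , oU , oU′ , Ua , U′b , _,_) , oV′ ,
       (Ux , U′y) , V′z , λ (Ua , U′b) V′c → sub Ua (sub′ U′b V′c)

module _ (em : ∀ {ℓ} → ExcludedMiddle ℓ) where
  open Classical em

  -- Open sets respect `_≈_`, and this passes through complements and projections. It is required
  -- because a captured point equals the outcome of its play only up to `_≈_`.
  Σ¹-resp-≈ : ∀ n .{{_ : NonZero n}} X {A} → Σ¹ n X A → A Respects (PolishSpace._≈_ X)
  Σ¹-resp-≈ (suc zero) X {A} (F , F-closed , A⊆ , ⊆A) x≈y Ax =
    let γ , Fxγ = A⊆ Ax
    in ⊆A (γ , ¬¬-elim λ ¬Fyγ → PolishSpace.Open-resp-≈ (X ⊗ 𝒩) F-closed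
         (IsEquivalence.sym (PolishSpace.isEquivalence X) x≈y , λ _ → refl) ¬Fyγ Fxγ)
  Σ¹-resp-≈ (suc (suc n)) X (B , B-Σ¹ , A⊆ , ⊆A) x≈y Ax =
    let γ , ¬Bxγ = A⊆ Ax
    in ⊆A (γ , λ Byγ → ¬Bxγ (Σ¹-resp-≈ (suc n) (X ⊗ 𝒩) B-Σ¹
         (IsEquivalence.sym (PolishSpace.isEquivalence X) x≈y , λ _ → refl) Byγ))

  module Universal (P : Presentation) where
    open Presentation P

    N-open : ∀ X s → PolishSpace.Open X (N X s)
    N-open X s = ball-open (metric X) (centre X (entry s 0)) (rational (entry s 1))

    U-open : ∀ X → PolishSpace.Open (𝒩 ⊗ X) (λ (α , x) → U X α x)
    U-open X (α , x) (n , x∈N) =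
      -- Membership is witnessed by the single value `α n`, which the first `suc n` values
      -- determine.
      Agree (suc n) α , N X (α n) ,
      lift (λ β α~β → suc n , λ γ β~γ i i<n → trans (α~β i i<n) (β~γ i i<n)) ,
      N-open X (α n) , (λ _ _ → refl) , x∈N ,
      λ {_} {y} α~β y∈N → n , subst (λ s → N X s y) (α~β n (ℕₚ.n<1+n n)) y∈N

    -- Both hierarchies project one variable at a time; their clauses match up to a continuous
    -- reassociation of products.
    G-Σ¹ : ∀ n .{{_ : NonZero n}} X → Σ¹ n (𝒩 ⊗ X) (λ (α , x) → G n X α x)
    G-Σ¹ (suc zero) X =
      assocʳ 𝒩 X 𝒩 ⊢ (λ (α , z) → F (X ⊗ 𝒩) α z) ,
      assocʳ-continuous 𝒩 X 𝒩 _ (PolishSpace.Open-resp-≐ (𝒩 ⊗ (X ⊗ 𝒩))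
        ((λ u ¬u → ¬u u) , ¬¬-elim) (U-open (X ⊗ 𝒩))) ,
      (λ g → g) , (λ g → g)
    G-Σ¹ (suc (suc n)) X =
      assocʳ 𝒩 X 𝒩 ⊢ (λ (α , z) → G (suc n) (X ⊗ 𝒩) α z) ,
      Σ¹-preimage (suc n) {(𝒩 ⊗ X) ⊗ 𝒩} {𝒩 ⊗ (X ⊗ 𝒩)} (assocʳ-continuous 𝒩 X 𝒩) (G-Σ¹ (suc n) (X ⊗ 𝒩)) ,
      (λ g → g) , (λ g → g)

determinacy⇒dichotomy : (em : ∀ {ℓ} → ExcludedMiddle ℓ) → ∀ n .{{_ : NonZero n}} → Σ¹-Determinacy n →
                        ∀ X {A} → Σ¹ n X A → Category.Dichotomy em X A
determinacy⇒dichotomy em n determinacy X A-Σ¹ s =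
  decided (Σ¹-resp-≈ em n X A-Σ¹) (determinacy _ (Σ¹-preimage n {𝒩} {X} outcome-continuous A-Σ¹))
  where open BanachMazur em X s

-- Sections of meager sets in a product.

module KuratowskiUlam (em : ∀ {ℓ} → ExcludedMiddle ℓ) (X Y : PolishSpace) where
  open Classical em
  private
    module X  = Category em X
    module Y  = Category em Y
    module XY = Category em (X ⊗ Y)

  section : Pred (Carrier (X ⊗ Y)) 0ℓ → Carrier X → Pred (Carrier Y) 0ℓ
  section A x y = A (x , y)

  DenseSection : Pred (Carrier (X ⊗ Y)) 0ℓ → ℕ → Pred (Carrier X) 0ℓ
  DenseSection A s x = ∀ t → Y.B t ⊆ Y.B s → ∃ λ y → Y.B t y × A (x , y)

  -- The box `u × s` contains a box `u′ × t` missing `A`. For `x` in `u′` the section misses `B t`,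
  -- hence is not dense in `B s`.
  DenseSection-nowhereDense : ∀ {A} → NowhereDense (topology (X ⊗ Y)) A → ∀ s →
                              NowhereDense (topology X) (DenseSection A s)
  DenseSection-nowhereDense {A} nd s = X.nowhereDense⁺ λ u →
    let w , _ , w⊆ = XY.basis {λ (x , y) → X.B u x × Y.B s y}
          (λ (x , y) (x∈u , y∈s) → X.B u , Y.B s , X.B-open u , Y.B-open s , x∈u , y∈s , _,_)
          (X.centre∈B u , Y.centre∈B s)
        v , v⊆w , avoids = XY.nowhereDense⁻ nd w
        V , V′ , oV , oV′ , Vx , V′y , sub = XY.B-open v (XY.centre v) (XY.centre∈B v)
        u′ , x∈u′ , u′⊆V = X.basis oV Vx
        t  , y∈t  , t⊆V′ = Y.basis oV′ V′y
    in u′ , (λ x∈ → proj₁ (w⊆ (v⊆w (sub (u′⊆V x∈) V′y)))) ,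
       λ {x} x∈ (dense : DenseSection A s x) →
         let y , y∈t , Axy = dense t (λ y∈ → proj₂ (w⊆ (v⊆w (sub Vx (t⊆V′ y∈)))))
         in avoids (sub (u′⊆V x∈) (t⊆V′ y∈t)) Axy

  ¬denseSection⇒nowhereDense : ∀ {A x} → (∀ s → ¬ DenseSection A s x) → NowhereDense (topology Y) (section A x)
  ¬denseSection⇒nowhereDense ¬dense = Y.nowhereDense⁺ λ s →
    let t , ¬p = ¬∀⇒∃¬ (¬dense s)
    -- `¬p` negates an implication, so classically its premise `B t ⊆ B s` holds and its conclusion
    -- fails.
    in t , (λ y∈t → ¬¬-elim λ y∉s → ¬p λ t⊆s → contradiction (t⊆s y∈t) y∉s) ,
       λ y∈t Axy → ¬p λ _ → _ , y∈t , Axy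

  -- A section dense in no ball is nowhere dense, and the exceptional `x` are covered by the
  -- countably many sets `DenseSection (M i) s`.
  meager⇒meagerSections : ∀ {A} → Meager (topology (X ⊗ Y)) A →
    ∃ λ C → Comeager (topology X) C × ∀ x → C x → Meager (topology Y) (section A x)
  meager⇒meagerSections (M , nd , A⊆M) =
    (λ x → ∀ i s → ¬ DenseSection (M i) s x) ,
    X.meager-⊆ (λ ¬all → let i , ¬s = ¬∀⇒∃¬ ¬all in i , map₂ ¬¬-elim (¬∀⇒∃¬ ¬s))
      (X.meager-⋃ λ i → X.meager-⋃ λ s → X.nowhereDense⇒meager (DenseSection-nowhereDense (nd i) s)) ,
    λ x ¬dense → (λ i → section (M i) x) , (λ i → ¬denseSection⇒nowhereDense {M i} {x} (¬dense i)) , A⊆M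

-- Continuous codes for the sections of an open set.

common-bound : (m : ℕ → ℕ) → ∀ n → ∃ λ M → ∀ {k} → k < n → m k ≤ M
common-bound m zero    = 0 , λ ()
common-bound m (suc n) =
  let M , bound = common-bound m n
  in m n ⊔ M , λ { {k} (s≤s k≤n) →
       [ (λ k<n → ℕₚ.≤-trans (bound k<n) (ℕₚ.m≤n⊔m (m n) M)) ,
         (λ k≡n → subst (λ j → m j ≤ m n ⊔ M) (sym k≡n) (ℕₚ.m≤m⊔n (m n) M)) ]′ (ℕₚ.m≤n⇒m<n∨m≡n k≤n) }

local⇒continuous : ∀ {u : Seq → Seq} (m : ℕ → ℕ) → (∀ k {α β} → Agree (m k) α β → u α k ≡ u β k) →
                   Continuous baire-topology baire-topology u
local⇒continuous {u} m local V oV = lift λ α Vuα →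
  let n , inV   = lower oV (u α) Vuα
      M , bound = common-bound m n
  in M , λ β α~β → inV (u β) λ k k<n →
       local k λ i i<mk → α~β i (ℕₚ.<-≤-trans i<mk (bound k<n))

fraction : ℕ → ℕ → ℚ
fraction a b = + a ℚ./ suc b

rational-0 : rational 0 ≡ 0ℚ
rational-0 = cong₂ fraction (entry-0 0) (entry-0 1)

rational-encode : ∀ m → rational (encode (1 ∷ m ∷ [])) ≡ unitFrac m
rational-encode m = cong₂ fraction (entry-encode (1 ∷ m ∷ []) 0) (entry-encode (1 ∷ m ∷ []) 1)

module CodedBalls (P : Presentation) (X : PolishSpace) where
  open Presentation P
  private
    module X = PolishSpace X
    module PX = Balls (metric X) (centre X) (centre-dense X)

  N≡ball : ∀ {s i q} → entry s 0 ≡ i → rational (entry s 1) ≡ q → N X s ≡ ball (metric X) (centre X i) q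
  N≡ball refl refl = refl

  N-0 : ∀ {x} → ¬ N X 0 x
  N-0 {x} x∈ = <ʳ0⇒⊥ {CompatibleMetric.dist (metric X) (centre X 0) x}
    (CompatibleMetric.nonNegative (metric X))
    (subst (λ W → W x) (N≡ball {0} (entry-0 0) (trans (cong rational (entry-0 1)) rational-0)) x∈)

  -- The inner pair `1`, `m` codes the radius: `rational` reads it as `unitFrac m`.
  ballCode : ℕ → ℕ → List ℕ
  ballCode i m = i ∷ encode (1 ∷ m ∷ []) ∷ []

  N-ballCode : ∀ i m → N X (encode (ballCode i m)) ≡ ball (metric X) (centre X i) (unitFrac m)
  N-ballCode i m = N≡ball {encode (ballCode i m)} (entry-encode (ballCode i m) 0)
    (trans (cong rational (entry-encode (ballCode i m) 1)) (rational-encode m))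

  -- The metric and dense sequence of the presentation need not be those stored in `X`; its own
  -- balls `PX.B` form a basis, and each of them has a code.
  N-basis : ∀ {V} → X.Open V → ∀ {x} → V x → ∃ λ s → N X s x × N X s ⊆ V
  N-basis {V} oV {x} Vx = fromB (PX.basis oV Vx)
    where
    fromB : (∃ λ t → PX.B t x × PX.B t ⊆ V) → ∃ λ s → N X s x × N X s ⊆ V
    fromB (t , x∈t , t⊆V) = encode (ballCode i m) ,
      subst (λ W → W x) Bt≡N x∈t , λ {y} y∈ → t⊆V (subst (λ W → W y) (sym Bt≡N) y∈)
      where
      i = proj₁ (unpair t)
      m = proj₂ (unpair t)
      Bt≡N : PX.B t ≡ N X (encode (ballCode i m))
      Bt≡N = trans (PX.B≡ball t) (sym (N-ballCode i m))

module SectionCode (em : ∀ {ℓ} → ExcludedMiddle ℓ) (X : PolishSpace)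
                   {B : ℕ → Pred (Carrier X) 0ℓ} (B-0 : ∀ {x} → ¬ B 0 x)
                   (B-basis : ∀ {V} → PolishSpace.Open X V → ∀ {x} → V x → ∃ λ s → B s x × B s ⊆ V)
                   {O : Pred (Carrier (𝒩 ⊗ X)) 0ℓ} (O-open : PolishSpace.Open (𝒩 ⊗ X) O) where

  Inside : ℕ → ℕ → Pred Seq 0ℓ
  Inside n s α = ∀ β → Agree n α β → ∀ {x} → B s x → O (β , x)

  Inside-local : ∀ n s {α β} → Agree n α β → Inside n s α → Inside n s β
  Inside-local n s α~β inside γ β~γ = inside γ λ i i<n → trans (α~β i i<n) (β~γ i i<n)

  private
    keep : ∀ {Q : Set} → Dec Q → ℕ → ℕ
    keep (yes _) s = s
    -- By `B-0` the value 0 contributes no points.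
    keep (no _)  s = 0

    keep-cong : ∀ {Q R : Set} (d : Dec Q) (e : Dec R) → (Q → R) → (R → Q) → ∀ s → keep d s ≡ keep e s
    keep-cong (yes _) (yes _) f g s = refl
    keep-cong (yes q) (no ¬r) f g s = contradiction (f q) ¬r
    keep-cong (no ¬q) (yes r) f g s = contradiction (g r) ¬q
    keep-cong (no _)  (no _)  f g s = refl

    keep-yes : ∀ {Q : Set} (d : Dec Q) → Q → ∀ s → keep d s ≡ s
    keep-yes (yes _) q s = refl
    keep-yes (no ¬q) q s = contradiction q ¬q

    keep-∈ : ∀ {Q : Set} (d : Dec Q) s {x} → B (keep d s) x → Q × B s x
    keep-∈ (yes q) s x∈ = q , x∈
    keep-∈ (no _)  s x∈ = contradiction x∈ B-0

  -- With unpair k = (n , s), the ball B s is listed at k only if the first n values of α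
  -- already force it into the section of O; this makes the code continuous in α.
  sectionCode : Seq → Seq
  sectionCode α k = keep (em {P = Inside (proj₁ (unpair k)) (proj₂ (unpair k)) α}) (proj₂ (unpair k))

  sectionCode-continuous : Continuous baire-topology baire-topology sectionCode
  sectionCode-continuous = local⇒continuous (proj₁ ∘ unpair) λ k α~β → keep-cong em em
    (Inside-local _ _ α~β) (Inside-local _ _ λ i i<n → sym (α~β i i<n)) (proj₂ (unpair k))

  sectionCode⊆ : ∀ {α x} → (∃ λ k → B (sectionCode α k) x) → O (α , x)
  sectionCode⊆ {α} (k , x∈) =
    let inside , x∈s = keep-∈ em (proj₂ (unpair k)) x∈ in inside α (λ _ _ → refl) x∈s

  ⊆sectionCode : ∀ {α x} → O (α , x) → ∃ λ k → B (sectionCode α k) x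
  ⊆sectionCode {α} {x} Oαx =
    let V , W , oV , oW , Vα , Wx , sub = O-open (α , x) Oαx
        n , inV       = lower oV α Vα
        s , x∈s , s⊆W = B-basis oW Wx
        k , eq        = unpair-surjective n s
        inside : Inside n s α
        inside β α~β x∈ = sub (inV β α~β) (s⊆W x∈)
    in k , subst (λ (n , s) → B (keep (em {P = Inside n s α}) s) x) (sym eq)
             (subst (λ s → B s x) (sym (keep-yes em inside s)) x∈s)

-- Baire property of the universal sets and codes of their sections.

Σ¹⇒dichotomy : (em : ∀ {ℓ} → ExcludedMiddle ℓ) → ∀ n .{{_ : NonZero n}} → (1 < n → Σ¹-Determinacy n) →
               ∀ X {A} → Σ¹ n X A → Category.Dichotomy em X A
Σ¹⇒dichotomy em (suc (suc n)) determinacy X A-Σ¹ = determinacy⇒dichotomy em (suc (suc n)) (determinacy (s≤s z<s)) X A-Σ¹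
Σ¹⇒dichotomy em (suc zero) _ X (F , F-closed , A⊆ , ⊆A) s with Analytic.dichotomy em X F-closed s
... | inj₁ m             = inj₁ (meager-⊆ (λ (p , q) → A⊆ p , q) m)
  where open Category em X
... | inj₂ (t , t⊆s , m) = inj₂ (t , t⊆s , meager-⊆ (λ (p , q) → p , q ∘ ⊆A) m)
  where open Category em X

meager-△-resp-≐ : (em : ∀ {ℓ} → ExcludedMiddle ℓ) → ∀ X {A O V} → O ⊆ V → V ⊆ O →
                  Meager (topology X) (A △ O) → Meager (topology X) (A △ V)
meager-△-resp-≐ em X O⊆V V⊆O = Category.meager-⊆ em X λ where
  (inj₁ (a , ¬v)) → inj₁ (a , ¬v ∘ O⊆V)
  (inj₂ (v , ¬a)) → inj₂ (V⊆O v , ¬a)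

-- The section of `A △ O` at `α` is by definition the symmetric difference of the two sections, and
-- `sectionCode` codes that of `O`.
codedSections : (em : ∀ {ℓ} → ExcludedMiddle ℓ) (X : PolishSpace) {B : ℕ → Pred (Carrier X) 0ℓ} →
                (∀ {x} → ¬ B 0 x) →
                (∀ {V} → PolishSpace.Open X V → ∀ {x} → V x → ∃ λ s → B s x × B s ⊆ V) →
                ∀ {A : Pred (Carrier (𝒩 ⊗ X)) 0ℓ} → Category.BaireProperty em (𝒩 ⊗ X) A →
                ∃ λ (u : Seq → Seq) → Continuous baire-topology baire-topology u ×
                  ∃ λ C → Comeager baire-topology C ×
                    (∀ α → C α → Meager (topology X) ((λ x → A (α , x)) △ (λ x → ∃ λ k → B (u α k) x)))
codedSections em X B-0 B-basis (O , O-open , A△O-meager) =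
  let C , C-comeager , sections = KuratowskiUlam.meager⇒meagerSections em 𝒩 X A△O-meager
  in sectionCode , sectionCode-continuous , C , C-comeager , λ α Cα →
     meager-△-resp-≐ em X ⊆sectionCode sectionCode⊆ (sections α Cα)
  where open SectionCode em X B-0 B-basis O-open

proposition3 :
    (∀ {ℓ} → ExcludedMiddle ℓ) →
    (P : Presentation) (n : ℕ) .{{_ : NonZero n}} →
    (1 < n → Σ¹-Determinacy n) →
    (X : PolishSpace) →
    let open Presentation P in
    ∃ λ (u : Seq → Seq) →
      Continuous (PolishSpace.topology 𝒩) (PolishSpace.topology 𝒩) u ×
      ∃ λ C → Comeager (PolishSpace.topology 𝒩) C ×
        (∀ α → C α → Meager (PolishSpace.topology X) (G n X α △ U X (u α)))
proposition3 em P n determinacy X =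
  codedSections em X {N X} N-0 N-basis {λ (α , x) → G n X α x}
    (dichotomy⇒baireProperty (Σ¹⇒dichotomy em n determinacy (𝒩 ⊗ X) (Universal.G-Σ¹ em P n X)))
  where
  open Presentation P
  open CodedBalls P X using (N-0; N-basis)
  open Category em (𝒩 ⊗ X) using (dichotomy⇒baireProperty)
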